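{- If $\beta$ is a real number such that $\beta\ge 2$, then the function $p_\beta:\mathbb{R}_+\to\mathbb{R}$, $x\mapsto x^\beta$, belongs to the class $\mathcal{F}$.
   Context: $\mathbb{N}=\{0,1,2,\dots\}$ and $\mathbb{R}_+=[0,\infty)$. The class $\mathcal{F}$ consists of all real-valued functions $f$ whose domain contains $\mathbb{N}$ and such that $f(0)=0$, $f(k+2)-f(k+1)>f(k+1)-f(k)$ for all $k\in\mathbb{N}$, and $(k-2)f(k)\ge k\,(f(k-1)-f(1))$ for all integers $k\ge 3$. -}

module Defs where

open import Algebra.Bundles using (CommutativeRing)
open import Algebra.Bundles.Raw using (RawMonoid)
import Algebra.Definitions.RawMonoid as RawMonoidDefinitions
open import Data.Integer.Base as ℤ using (+_; -[1+_])
import Data.Integer.Properties as ℤ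
open import Data.Nat.Base as ℕ using (ℕ; zero; suc)
open import Data.Nat.Coprimality as Coprimality using (Coprime)
import Data.Nat.Properties as ℕ
open import Data.Product.Base using (∃₂; ∃-syntax; Σ-syntax; _×_; _,_; proj₁; proj₂)
open import Data.Rational.Base as ℚ using (ℚ; mkℚ; 0ℚ; 1ℚ; ½; _+_; _*_; _-_; -_; _<_; _≤_; _/_; +-*-rawSemiring; +-0-rawMonoid)
import Data.Rational.Properties as ℚ
open import Data.Rational.Unnormalised.Base as ℚᵘ using (mkℚᵘ)
import Data.Rational.Unnormalised.Properties as ℚᵘ
open import Data.Sum.Base using (_⊎_; inj₁; inj₂; swap; map₁)
open import Relation.Binary.Definitions using (tri<; tri≈; tri>)
open import Relation.Binary.PropositionalEquality using (_≡_; refl; sym; trans; cong; subst; subst₂; module ≡-Reasoning)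
open import Relation.Nullary using (¬_; Dec; yes; no; contradiction)
open import Relation.Nullary.Decidable using (dec⇒maybe)
open import Tactic.RingSolver using (solve-∀)
open import Tactic.RingSolver.Core.AlmostCommutativeRing using (AlmostCommutativeRing; fromCommutativeRing)

open import Algebra.Definitions.RawSemiring +-*-rawSemiring using (_^_)
open import Algebra.Properties.Semiring.Exp (CommutativeRing.semiring ℚ.+-*-commutativeRing) using (^-assocʳ)
open RawMonoidDefinitions +-0-rawMonoid using () renaming (_×_ to _·_)

ℚ-ring : AlmostCommutativeRing _ _
ℚ-ring = fromCommutativeRing ℚ.+-*-commutativeRing (λ p → dec⇒maybe (0ℚ ℚ.≟ p))

module RationalLemmas where

  <⇒0<- : ∀ {p q} → p < q → 0ℚ < q - p
  <⇒0<- {p} {q} p<q = subst (_< q - p) (ℚ.+-inverseʳ p) (ℚ.+-monoˡ-< (- p) p<q)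

  ≤⇒0≤- : ∀ {p q} → p ≤ q → 0ℚ ≤ q - p
  ≤⇒0≤- {p} {q} p≤q = subst (_≤ q - p) (ℚ.+-inverseʳ p) (ℚ.+-monoˡ-≤ (- p) p≤q)

  +-minus : ∀ p q → p + (q - p) ≡ q
  +-minus = solve-∀ ℚ-ring

  0<-⇒< : ∀ {p q d} → q - p ≡ d → 0ℚ < d → p < q
  0<-⇒< {p} {q} refl 0<d =
    subst₂ _<_ (ℚ.+-identityʳ p) (+-minus p q) (ℚ.+-monoʳ-< p 0<d)

  0≤-⇒≤ : ∀ {p q d} → q - p ≡ d → 0ℚ ≤ d → p ≤ q
  0≤-⇒≤ {p} {q} refl 0≤d =
    subst₂ _≤_ (ℚ.+-identityʳ p) (+-minus p q) (ℚ.+-monoʳ-≤ p 0≤d)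

  +-pos : ∀ {p q} → 0ℚ < p → 0ℚ < q → 0ℚ < p + q
  +-pos = ℚ.+-mono-<

  +-nonneg : ∀ {p q} → 0ℚ ≤ p → 0ℚ ≤ q → 0ℚ ≤ p + q
  +-nonneg = ℚ.+-mono-≤

  *-pos : ∀ {p q} → 0ℚ < p → 0ℚ < q → 0ℚ < p * q
  *-pos {p} {q} 0<p 0<q =
    subst (_< p * q) (ℚ.*-zeroʳ p) (ℚ.*-monoʳ-<-pos p {{ℚ.positive 0<p}} 0<q)

  *-monoˡ : ∀ {p q r} → 0ℚ ≤ r → p ≤ q → r * p ≤ r * q
  *-monoˡ {r = r} 0≤r = ℚ.*-monoˡ-≤-nonNeg r {{ℚ.nonNegative 0≤r}}

  *-monoʳ : ∀ {p q r} → 0ℚ ≤ r → p ≤ q → p * r ≤ q * r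
  *-monoʳ {r = r} 0≤r = ℚ.*-monoʳ-≤-nonNeg r {{ℚ.nonNegative 0≤r}}

  *-nonneg : ∀ {p q} → 0ℚ ≤ p → 0ℚ ≤ q → 0ℚ ≤ p * q
  *-nonneg {p} {q} 0≤p 0≤q = subst (_≤ p * q) (ℚ.*-zeroʳ p) (*-monoˡ 0≤p 0≤q)

  *-mono : ∀ {p q r s} → 0ℚ ≤ p → p ≤ q → 0ℚ ≤ r → r ≤ s → p * r ≤ q * s
  *-mono 0≤p p≤q 0≤r r≤s =
    ℚ.≤-trans (*-monoʳ 0≤r p≤q) (*-monoˡ (ℚ.≤-trans 0≤p p≤q) r≤s)

  0<1 : 0ℚ < 1ℚ
  0<1 = ℚ.positive⁻¹ 1ℚ

  0<½ : 0ℚ < ½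
  0<½ = ℚ.positive⁻¹ ½

  p<p+1 : ∀ p → p < p + 1ℚ
  p<p+1 p = subst (_< p + 1ℚ) (ℚ.+-identityʳ p) (ℚ.+-monoʳ-< p 0<1)

  p-1<p : ∀ p → p - 1ℚ < p
  p-1<p p = 0<-⇒< (lemma p) 0<1
    where
    lemma : ∀ p → p - (p - 1ℚ) ≡ 1ℚ
    lemma = solve-∀ ℚ-ring

  p½+p½ : ∀ p → p * ½ + p * ½ ≡ p
  p½+p½ p = trans (sym (ℚ.*-distribˡ-+ p ½ ½)) (ℚ.*-identityʳ p)

  half-pos : ∀ {p} → 0ℚ < p → 0ℚ < p * ½
  half-pos 0<p = *-pos 0<p 0<½

  half< : ∀ {p} → 0ℚ < p → p * ½ < p
  half< {p} 0<p = 0<-⇒< (trans (cong (_- p * ½) (sym (p½+p½ p))) (lemma (p * ½))) (half-pos 0<p)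
    where
    lemma : ∀ p → p + p - p ≡ p
    lemma = solve-∀ ℚ-ring

  ∃<₂ : ∀ {p q} → 0ℚ < p → 0ℚ < q → ∃[ r ] 0ℚ < r × r < p × r < q
  ∃<₂ {p} {q} 0<p 0<q with ℚ.≤-total p q
  ... | inj₁ p≤q = p * ½ , half-pos 0<p , half< 0<p , ℚ.<-≤-trans (half< 0<p) p≤q
  ... | inj₂ q≤p = q * ½ , half-pos 0<q , ℚ.<-≤-trans (half< 0<q) q≤p , half< 0<q

  inverse : ∀ {p} → 0ℚ < p → ∃[ r ] 0ℚ < r × p * r ≡ 1ℚ
  inverse {p} 0<p = ℚ.1/ p , ℚ.positive⁻¹ _ {{ℚ.1/pos⇒pos p}} , ℚ.*-inverseʳ p
    where
    instance
      p-pos : ℚ.Positive p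
      p-pos = ℚ.positive 0<p
      p-nonZero : ℚ.NonZero p
      p-nonZero = ℚ.pos⇒nonZero p

  ∃ε*c< : ∀ {c p} → 0ℚ ≤ c → 0ℚ < p → ∃[ ε ] 0ℚ < ε × ε * c < p
  ∃ε*c< {c} {p} 0≤c 0<p =
    p * r , *-pos 0<p 0<r , 0<-⇒< (lemma p r c) (subst (0ℚ <_) (sym shrink) (*-pos 0<p 0<r))
    where
    1+c-inv = inverse (ℚ.<-≤-trans 0<1 (subst (_≤ 1ℚ + c) (ℚ.+-identityʳ 1ℚ) (ℚ.+-monoʳ-≤ 1ℚ 0≤c)))
    r = proj₁ 1+c-inv
    0<r = proj₁ (proj₂ 1+c-inv)
    [1+c]r≡1 = proj₂ (proj₂ 1+c-inv)
    lemma : ∀ p r c → p - p * r * c ≡ p - p * ((1ℚ + c) * r) + p * r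
    lemma = solve-∀ ℚ-ring
    lemma′ : ∀ p r → p - p * 1ℚ + p * r ≡ p * r
    lemma′ = solve-∀ ℚ-ring
    shrink : p - p * ((1ℚ + c) * r) + p * r ≡ p * r
    shrink = trans (cong (λ z → p - p * z + p * r) [1+c]r≡1) (lemma′ p r)

  ·-nonneg : ∀ {p} n → 0ℚ ≤ p → 0ℚ ≤ n · p
  ·-nonneg zero    0≤p = ℚ.≤-refl
  ·-nonneg (suc n) 0≤p = +-nonneg 0≤p (·-nonneg n 0≤p)

  n/1 : ∀ n .{c : Coprime n 1} → + n / 1 ≡ mkℚ (+ n) 0 c
  n/1 n {c} = ℚ.↥p/↧p≡p (mkℚ (+ n) 0 c)

  frac<⇒ : ∀ a b c d → + a / suc b < + c / suc d → a ℕ.* suc d ℕ.< c ℕ.* suc b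
  frac<⇒ a b c d lt
    with ℚᵘ.<-respˡ-≃ (ℚ.toℚᵘ-fromℚᵘ (mkℚᵘ (+ a) b))
           (ℚᵘ.<-respʳ-≃ (ℚ.toℚᵘ-fromℚᵘ (mkℚᵘ (+ c) d)) (ℚ.toℚᵘ-mono-< lt))
  ... | ℚᵘ.*<* lt′ = ℤ.drop‿+<+ (subst₂ ℤ._<_ (sym (ℤ.pos-* a (suc d))) (sym (ℤ.pos-* c (suc b))) lt′)

  frac<⇐ : ∀ a b c d → a ℕ.* suc d ℕ.< c ℕ.* suc b → + a / suc b < + c / suc d
  frac<⇐ a b c d lt = ℚ.toℚᵘ-cancel-<
    (ℚᵘ.<-respˡ-≃ (ℚᵘ.≃-sym (ℚ.toℚᵘ-fromℚᵘ (mkℚᵘ (+ a) b)))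
      (ℚᵘ.<-respʳ-≃ (ℚᵘ.≃-sym (ℚ.toℚᵘ-fromℚᵘ (mkℚᵘ (+ c) d)))
        (ℚᵘ.*<* (subst₂ ℤ._<_ (ℤ.pos-* a (suc d)) (ℤ.pos-* c (suc b)) (ℤ.+<+ lt)))))

  1/<  : ∀ {p} → 0ℚ < p → ∃[ b ] + 1 / suc b < p
  1/< {mkℚ (+ zero) d _} (ℚ.*<* 0<0) = contradiction 0<0 (ℤ.<-irrefl refl)
  1/< {mkℚ -[1+ n ] d _} (ℚ.*<* ())
  1/< p@{mkℚ (+ suc n) d _} _ = suc d , ℚ.toℚᵘ-cancel-<
    (ℚᵘ.<-respˡ-≃ (ℚᵘ.≃-sym (ℚ.toℚᵘ-fromℚᵘ (mkℚᵘ (+ 1) (suc d))))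
      (ℚᵘ.*<* (subst₂ ℤ._<_ (ℤ.pos-* 1 (suc d)) (ℤ.pos-* (suc n) (suc (suc d)))
        (ℤ.+<+ (ℕ.<-≤-trans (ℕ.*-monoʳ-< 1 (ℕ.n<1+n (suc d)))
                        (ℕ.*-monoˡ-≤ (suc (suc d)) {1} {suc n} (ℕ.s≤s ℕ.z≤n)))))))

  <frac : ∀ p b → ∃[ a ] p < + a / suc b
  <frac p@(mkℚ num d _) b = a , ℚ.toℚᵘ-cancel-<
    (ℚᵘ.<-respʳ-≃ (ℚᵘ.≃-sym (ℚ.toℚᵘ-fromℚᵘ (mkℚᵘ (+ a) b))) (ℚᵘ.*<* (bound num)))
    where
    a = suc ℤ.∣ num ∣ ℕ.* suc b
    bound : ∀ i → i ℤ.* + suc b ℤ.< + (suc ℤ.∣ i ∣ ℕ.* suc b) ℤ.* + suc d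
    bound (+ n) = subst₂ ℤ._<_ (ℤ.pos-* n (suc b)) (ℤ.pos-* a′ (suc d))
      (ℤ.+<+ (ℕ.<-≤-trans (ℕ.*-monoˡ-< (suc b) (ℕ.n<1+n n)) (ℕ.m≤m*n a′ (suc d))))
      where a′ = suc n ℕ.* suc b
    bound -[1+ n ] = ℤ.-<+

  1+n/1 : ∀ n → + suc n / 1 ≡ 1ℚ + + n / 1
  1+n/1 n = trans (n/1 (suc n) {c (suc n)}) (sym (trans (cong (λ z → 1ℚ + z) (n/1 n {c n}))
     (trans (cong (_/ 1) (cong (ℤ._+_ (+ 1)) (ℤ.*-identityʳ (+ n)))) (n/1 (suc n) {c (suc n)}))))
    where
    c : ∀ n → Coprime n 1
    c n = Coprimality.sym (Coprimality.1-coprimeTo n)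

  n·p : ∀ n p → n · p ≡ + n / 1 * p
  n·p zero    p = sym (ℚ.*-zeroˡ p)
  n·p (suc n) p = begin
    p + n · p               ≡⟨ cong (λ z → p + z) (n·p n p) ⟩
    p + + n / 1 * p         ≡⟨ lemma p (+ n / 1) ⟩
    (1ℚ + + n / 1) * p      ≡⟨ cong (_* p) (1+n/1 n) ⟨
    + suc n / 1 * p         ∎
    where
    open ≡-Reasoning
    lemma : ∀ p q → p + q * p ≡ (1ℚ + q) * p
    lemma = solve-∀ ℚ-ring

  <n· : ∀ p {q} → 0ℚ < q → ∃[ n ] p < n · q
  <n· p {q} 0<q with inverse 0<q
  ... | r , 0<r , qr≡1 with <frac (p * r) 0
  ... | n , pr<n = n , subst₂ _<_ prq≡p (sym (n·p n q)) (ℚ.*-monoˡ-<-pos q {{ℚ.positive 0<q}} pr<n)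
    where
    prq≡p : p * r * q ≡ p
    prq≡p = trans (ℚ.*-assoc p r q)
      (trans (cong (p *_) (trans (ℚ.*-comm r q) qr≡1)) (ℚ.*-identityʳ p))

  ^-pos : ∀ {p} n → 0ℚ < p → 0ℚ < p ^ n
  ^-pos zero    0<p = 0<1
  ^-pos (suc n) 0<p = *-pos 0<p (^-pos n 0<p)

  ^-nonneg : ∀ {p} n → 0ℚ ≤ p → 0ℚ ≤ p ^ n
  ^-nonneg zero    0≤p = ℚ.<⇒≤ 0<1
  ^-nonneg (suc n) 0≤p = *-nonneg 0≤p (^-nonneg n 0≤p)

  ^-monoˡ-≤ : ∀ {p q} n → 0ℚ ≤ p → p ≤ q → p ^ n ≤ q ^ n
  ^-monoˡ-≤ zero    0≤p p≤q = ℚ.≤-refl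
  ^-monoˡ-≤ (suc n) 0≤p p≤q = *-mono 0≤p p≤q (^-nonneg n 0≤p) (^-monoˡ-≤ n 0≤p p≤q)

  ^-monoˡ-< : ∀ {p q} n → 0ℚ ≤ p → p < q → p ^ suc n < q ^ suc n
  ^-monoˡ-< {p} {q} n 0≤p p<q = ℚ.≤-<-trans
    (*-monoˡ 0≤p (^-monoˡ-≤ n 0≤p (ℚ.<⇒≤ p<q)))
    (ℚ.*-monoˡ-<-pos (q ^ n) {{ℚ.positive (^-pos n (ℚ.≤-<-trans 0≤p p<q))}} p<q)

  1≤^ : ∀ {p} n → 1ℚ ≤ p → 1ℚ ≤ p ^ n
  1≤^ {p} n 1≤p = subst (_≤ p ^ n) (1^ n) (^-monoˡ-≤ n (ℚ.<⇒≤ 0<1) 1≤p)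
    where
    1^ : ∀ n → 1ℚ ^ n ≡ 1ℚ
    1^ zero    = refl
    1^ (suc n) = trans (ℚ.*-identityˡ (1ℚ ^ n)) (1^ n)

  ^≤1 : ∀ {p} n → 0ℚ ≤ p → p ≤ 1ℚ → p ^ n ≤ 1ℚ
  ^≤1 zero    0≤p p≤1 = ℚ.≤-refl
  ^≤1 {p} (suc n) 0≤p p≤1 = *-mono 0≤p p≤1 (^-nonneg n 0≤p) (^≤1 n 0≤p p≤1)

  ^-monoʳ-≤ : ∀ {p m n} → 1ℚ ≤ p → m ℕ.≤ n → p ^ m ≤ p ^ n
  ^-monoʳ-≤ {n = n} 1≤p ℕ.z≤n       = 1≤^ n 1≤p
  ^-monoʳ-≤         1≤p (ℕ.s≤s m≤n) =
    *-monoˡ (ℚ.≤-trans (ℚ.<⇒≤ 0<1) 1≤p) (^-monoʳ-≤ 1≤p m≤n)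

  ^-antimonoʳ-≤ : ∀ {p m n} → 0ℚ ≤ p → p ≤ 1ℚ → m ℕ.≤ n → p ^ n ≤ p ^ m
  ^-antimonoʳ-≤ {n = n} 0≤p p≤1 ℕ.z≤n       = ^≤1 n 0≤p p≤1
  ^-antimonoʳ-≤         0≤p p≤1 (ℕ.s≤s m≤n) = *-monoˡ 0≤p (^-antimonoʳ-≤ 0≤p p≤1 m≤n)

  lipschitz : ℚ → ℕ → ℚ
  lipschitz v zero    = 0ℚ
  lipschitz v (suc n) = v ^ n + v * lipschitz v n

  lipschitz-nonneg : ∀ {v} n → 0ℚ ≤ v → 0ℚ ≤ lipschitz v n
  lipschitz-nonneg zero    0≤v = ℚ.≤-refl
  lipschitz-nonneg (suc n) 0≤v = +-nonneg (^-nonneg n 0≤v) (*-nonneg 0≤v (lipschitz-nonneg n 0≤v))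

  ^-lipschitz : ∀ {u v w} n → 0ℚ ≤ u → u ≤ v → v ≤ w →
                v ^ n ≤ u ^ n + (v - u) * lipschitz w n
  ^-lipschitz {u} {v} {w} zero 0≤u u≤v v≤w =
    0≤-⇒≤ (lemma u v) ℚ.≤-refl
    where
    lemma : ∀ u v → 1ℚ + (v - u) * 0ℚ - 1ℚ ≡ 0ℚ
    lemma = solve-∀ ℚ-ring
  ^-lipschitz {u} {v} {w} (suc n) 0≤u u≤v v≤w = 0≤-⇒≤
    (lemma u v w (u ^ n) (v ^ n) (w ^ n) (lipschitz w n))
    (+-nonneg
      (+-nonneg
        (*-nonneg 0≤u (≤⇒0≤- (^-lipschitz n 0≤u u≤v v≤w)))
        (*-nonneg 0≤v-u (≤⇒0≤- (^-monoˡ-≤ n (ℚ.≤-trans 0≤u u≤v) v≤w))))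
      (*-nonneg (*-nonneg 0≤v-u (lipschitz-nonneg n 0≤w))
        (≤⇒0≤- (ℚ.≤-trans u≤v v≤w))))
    where
    0≤v-u = ≤⇒0≤- u≤v
    0≤w = ℚ.≤-trans 0≤u (ℚ.≤-trans u≤v v≤w)
    lemma : ∀ u v w a b c l →
      u * a + (v - u) * (c + w * l) - v * b ≡
      u * (a + (v - u) * l - b) + (v - u) * (c - b) + (v - u) * l * (w - u)
    lemma = solve-∀ ℚ-ring

  ∃>^< : ∀ {p m} n → 0ℚ ≤ p → p ^ n < m → ∃[ q ] p < q × q ^ n < m
  ∃>^< {p} {m} n 0≤p pⁿ<m = result (∃ε*c< 0≤c (<⇒0<- pⁿ<m))
    where
    c = lipschitz (p + 1ℚ) n
    0≤c : 0ℚ ≤ c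
    0≤c = lipschitz-nonneg n (ℚ.<⇒≤ (ℚ.≤-<-trans 0≤p (p<p+1 p)))
    +-cancel : ∀ p ε → p + ε - p ≡ ε
    +-cancel = solve-∀ ℚ-ring
    rearrange : ∀ m a b d e → m - b ≡ (a + d - b) + (e - d) + (m - a - e)
    rearrange = solve-∀ ℚ-ring
    result : ∃[ δ ] 0ℚ < δ × δ * c < m - p ^ n → ∃[ q ] p < q × q ^ n < m
    result (δ , 0<δ , δc<) = finish (∃<₂ 0<δ 0<1)
      where
      finish : ∃[ ε ] 0ℚ < ε × ε < δ × ε < 1ℚ → ∃[ q ] p < q × q ^ n < m
      finish (ε , 0<ε , ε<δ , ε<1) = p + ε , p<p+ε ,
        0<-⇒< (rearrange m (p ^ n) ((p + ε) ^ n) (ε * c) (δ * c))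
          (ℚ.+-mono-≤-<
            (+-nonneg
              (≤⇒0≤- (subst (λ z → (p + ε) ^ n ≤ p ^ n + z * c) (+-cancel p ε)
                (^-lipschitz n 0≤p (ℚ.<⇒≤ p<p+ε) (ℚ.+-monoʳ-≤ p (ℚ.<⇒≤ ε<1)))))
              (≤⇒0≤- (*-monoʳ 0≤c (ℚ.<⇒≤ ε<δ))))
            (<⇒0<- δc<))
        where
        p<p+ε : p < p + ε
        p<p+ε = 0<-⇒< (+-cancel p ε) 0<ε

  ∃<<^ : ∀ {q m} n → 0ℚ < q → m < q ^ n → ∃[ p ] 0ℚ < p × p < q × m < p ^ n
  ∃<<^ {q} {m} n 0<q m<qⁿ = result (∃ε*c< 0≤c (<⇒0<- m<qⁿ))
    where
    c = lipschitz q n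
    0≤c : 0ℚ ≤ c
    0≤c = lipschitz-nonneg n (ℚ.<⇒≤ 0<q)
    minus-minus : ∀ q ε → q - (q - ε) ≡ ε
    minus-minus = solve-∀ ℚ-ring
    rearrange : ∀ m a b d e → b - m ≡ (b + d - a) + (e - d) + (a - m - e)
    rearrange = solve-∀ ℚ-ring
    result : ∃[ δ ] 0ℚ < δ × δ * c < q ^ n - m →
             ∃[ p ] 0ℚ < p × p < q × m < p ^ n
    result (δ , 0<δ , δc<) = finish (∃<₂ 0<δ 0<q)
      where
      finish : ∃[ ε ] 0ℚ < ε × ε < δ × ε < q → ∃[ p ] 0ℚ < p × p < q × m < p ^ n
      finish (ε , 0<ε , ε<δ , ε<q) = q - ε , 0<q-ε , q-ε<q ,
        0<-⇒< (rearrange m (q ^ n) ((q - ε) ^ n) (ε * c) (δ * c))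
          (ℚ.+-mono-≤-<
            (+-nonneg
              (≤⇒0≤- (subst (λ z → q ^ n ≤ (q - ε) ^ n + z * c) (minus-minus q ε)
                (^-lipschitz n (ℚ.<⇒≤ 0<q-ε) (ℚ.<⇒≤ q-ε<q) ℚ.≤-refl)))
              (≤⇒0≤- (*-monoʳ 0≤c (ℚ.<⇒≤ ε<δ))))
            (<⇒0<- δc<))
        where
        0<q-ε : 0ℚ < q - ε
        0<q-ε = <⇒0<- ε<q
        q-ε<q : q - ε < q
        q-ε<q = 0<-⇒< (minus-minus q ε) 0<ε

  bernoulli : ∀ {p h} n → 0ℚ ≤ p → 0ℚ ≤ h → p ^ n * (1ℚ + n · h) ≤ (p + p * h) ^ n
  bernoulli zero _ _ = ℚ.≤-refl
  bernoulli {p} {h} (suc n) 0≤p 0≤h = ℚ.≤-trans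
    (0≤-⇒≤ (lemma p h (p ^ n) (n · h))
      (*-nonneg (*-nonneg (*-nonneg 0≤p 0≤h) (^-nonneg n 0≤p)) (·-nonneg n 0≤h)))
    (*-monoˡ (+-nonneg 0≤p (*-nonneg 0≤p 0≤h)) (bernoulli n 0≤p 0≤h))
    where
    lemma : ∀ p h a b → (p + p * h) * (a * (1ℚ + b)) - p * a * (1ℚ + (h + b)) ≡ p * h * a * b
    lemma = solve-∀ ℚ-ring

  ∃^*<^ : ∀ {p q} m → 0ℚ < p → p < q → ∃[ n ] p ^ suc n * m < q ^ suc n
  ∃^*<^ {p} {q} m 0<p p<q = finish (<n· m 0<h)
    where
    r = proj₁ (inverse 0<p)
    h = (q - p) * r
    0<h : 0ℚ < h
    0<h = *-pos (<⇒0<- p<q) (proj₁ (proj₂ (inverse 0<p)))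
    pull-out : ∀ p q r → p + p * ((q - p) * r) ≡ p + (q - p) * (p * r)
    pull-out = solve-∀ ℚ-ring
    p+[q-p] : ∀ p q → p + (q - p) * 1ℚ ≡ q
    p+[q-p] = solve-∀ ℚ-ring
    p+ph≡q : p + p * h ≡ q
    p+ph≡q = trans (pull-out p q r)
      (trans (cong (λ z → p + (q - p) * z) (proj₂ (proj₂ (inverse 0<p)))) (p+[q-p] p q))
    rearrange : ∀ m h a → 1ℚ + (h + a) - m ≡ 1ℚ + h + (a - m)
    rearrange = solve-∀ ℚ-ring
    finish : ∃[ n ] m < n · h → ∃[ n ] p ^ suc n * m < q ^ suc n
    finish (n , m<nh) = n , ℚ.<-≤-trans
      (ℚ.*-monoʳ-<-pos (p ^ suc n) {{ℚ.positive (^-pos (suc n) 0<p)}}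
        (0<-⇒< (rearrange m h (n · h)) (+-pos (+-pos 0<1 0<h) (<⇒0<- m<nh))))
      (subst (λ z → p ^ suc n * (1ℚ + suc n · h) ≤ z ^ suc n) p+ph≡q
        (bernoulli (suc n) (ℚ.<⇒≤ 0<p) (ℚ.<⇒≤ 0<h)))

-- Two-sided Dedekind cuts: lower x p says p < x, and upper x q says x < q.
record ℝ : Set₁ where
  field
    lower           : ℚ → Set
    upper           : ℚ → Set
    lower-inhabited : ∃[ p ] lower p
    upper-inhabited : ∃[ q ] upper q
    lower-closed    : ∀ {p q} → p < q → lower q → lower p
    upper-closed    : ∀ {p q} → p < q → upper p → upper q
    lower-open      : ∀ {p} → lower p → ∃[ q ] p < q × lower q
    upper-open      : ∀ {q} → upper q → ∃[ p ] p < q × upper p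
    disjoint        : ∀ {p} → lower p → ¬ upper p
    located         : ∀ {p q} → p < q → lower p ⊎ upper q

open ℝ public

infix 4 _<ℝ_ _≤ℝ_ _≥ℝ_ _>ℝ_ _≃ℝ_

_<ℝ_ _≤ℝ_ _>ℝ_ _≥ℝ_ _≃ℝ_ : ℝ → ℝ → Set
x <ℝ y = ∃[ q ] upper x q × lower y q
x ≤ℝ y = ∀ q → lower x q → lower y q
x >ℝ y = y <ℝ x
x ≥ℝ y = y ≤ℝ x
x ≃ℝ y = x ≤ℝ y × y ≤ℝ x

module Cuts where
  open RationalLemmas

  lower<upper : ∀ x {p q} → lower x p → upper x q → p < q
  lower<upper x {p} {q} Lp Uq with ℚ.<-cmp p q
  ... | tri< p<q _ _  = p<q
  ... | tri≈ _ refl _ = contradiction Uq (disjoint x Lp)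
  ... | tri> _ _ q<p  = contradiction Uq (disjoint x (lower-closed x q<p Lp))

  lower-closed-≤ : ∀ x {p q} → p ≤ q → lower x q → lower x p
  lower-closed-≤ x {p} {q} p≤q Lq with ℚ.<-cmp p q
  ... | tri< p<q _ _  = lower-closed x p<q Lq
  ... | tri≈ _ refl _ = Lq
  ... | tri> _ _ q<p  = contradiction (ℚ.<-≤-trans q<p p≤q) (ℚ.<-irrefl refl)

  ≤⇒upper : ∀ x y → x ≤ℝ y → ∀ {q} → upper y q → upper x q
  ≤⇒upper x y x≤y Uq with upper-open y Uq
  ... | p , p<q , Up with located x p<q
  ...   | inj₁ Lp  = contradiction Up (disjoint y (x≤y p Lp))
  ...   | inj₂ Uxq = Uxq

  approximate : ∀ x {ε} → 0ℚ < ε → ∃₂ λ p q → lower x p × upper x q × q - p < ε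
  approximate x {ε} 0<ε = start (lower-inhabited x) (upper-inhabited x)
    where
    Approximation = ∃₂ λ p q → lower x p × upper x q × q - p < ε
    δ = ε * ½ * ½
    0<δ : 0ℚ < δ
    0<δ = half-pos (half-pos 0<ε)
    width : ∀ p d → p + (d + d) - p ≡ d + d
    width = solve-∀ ℚ-ring
    width< : ∀ p → p + (δ + δ) - p < ε
    width< p = subst (_< ε) (sym (trans (width p δ) (p½+p½ (ε * ½)))) (half< 0<ε)
    step< : ∀ p → p + δ < p + (δ + δ)
    step< p = ℚ.+-monoʳ-< p (subst (_< δ + δ) (ℚ.+-identityʳ δ) (ℚ.+-monoʳ-< δ 0<δ))
    walk : ∀ n {p} → lower x p → upper x (p + n · δ) → Approximation
    walk zero {p} Lp Up =
      contradiction (subst (upper x) (ℚ.+-identityʳ p) Up) (disjoint x Lp)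
    walk (suc n) {p} Lp Up with located x (step< p)
    ... | inj₁ Lp+δ = walk n Lp+δ (subst (upper x) (sym (ℚ.+-assoc p δ (n · δ))) Up)
    ... | inj₂ Uq   = p , p + (δ + δ) , Lp , Uq , width< p
    start : ∃[ p ] lower x p → ∃[ q ] upper x q → Approximation
    start (p , Lp) (q , Uq) = reach (<n· (q - p) 0<δ)
      where
      reach : ∃[ n ] q - p < n · δ → Approximation
      reach (n , q-p<nδ) = walk n Lp (upper-closed x
        (subst (_< p + n · δ) (+-minus p q) (ℚ.+-monoʳ-< p q-p<nδ)) Uq)

  approximate-within : ∀ x {p q ε} → lower x p → upper x q → 0ℚ < ε →
    ∃₂ λ r s → lower x r × upper x s × p ≤ r × s ≤ q × s - r < ε
  approximate-within x {p} {q} {ε} Lp Uq 0<ε = shrink (approximate x 0<ε)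
    where
    shrink : (∃₂ λ r s → lower x r × upper x s × s - r < ε) →
             ∃₂ λ r s → lower x r × upper x s × p ≤ r × s ≤ q × s - r < ε
    shrink (r , s , Lr , Us , s-r<ε) = p⊔r , q⊓s , L , U , ℚ.p≤p⊔q p r , ℚ.p⊓q≤p q s ,
      ℚ.≤-<-trans (ℚ.+-mono-≤ (ℚ.p⊓q≤q q s) (ℚ.neg-antimono-≤ (ℚ.p≤q⊔p p r))) s-r<ε
      where
      p⊔r = p ℚ.⊔ r
      q⊓s = q ℚ.⊓ s
      L : lower x p⊔r
      L with ℚ.⊔-sel p r
      ... | inj₁ eq = subst (lower x) (sym eq) Lp
      ... | inj₂ eq = subst (lower x) (sym eq) Lr
      U : upper x q⊓s
      U with ℚ.⊓-sel q s
      ... | inj₁ eq = subst (upper x) (sym eq) Uq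
      ... | inj₂ eq = subst (upper x) (sym eq) Us

open RationalLemmas
open Cuts

fromℚ : ℚ → ℝ
fromℚ q = record
  { lower           = _< q
  ; upper           = q <_
  ; lower-inhabited = q - 1ℚ , p-1<p q
  ; upper-inhabited = q + 1ℚ , p<p+1 q
  ; lower-closed    = ℚ.<-trans
  ; upper-closed    = λ p<r q<p → ℚ.<-trans q<p p<r
  ; lower-open      = λ p<q → let r , p<r , r<q = ℚ.<-dense p<q in r , p<r , r<q
  ; upper-open      = λ q<p → let r , q<r , r<p = ℚ.<-dense q<p in r , r<p , q<r
  ; disjoint        = ℚ.<-asym
  ; located         = locate
  }
  where
  locate : ∀ {p r} → p < r → p < q ⊎ q < r
  locate {p} {r} p<r with p ℚ.<? q
  ... | yes p<q = inj₁ p<q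
  ... | no  p≮q = inj₂ (ℚ.≤-<-trans (ℚ.≮⇒≥ p≮q) p<r)

fromℕ : ℕ → ℝ
fromℕ n = fromℚ (+ n / 1)

0ℝ : ℝ
0ℝ = fromℕ 0

infix  8 -ℝ_
infixl 6 _+ℝ_ _-ℝ_

_+ℝ_ : ℝ → ℝ → ℝ
x +ℝ y = record
  { lower           = L
  ; upper           = U
  ; lower-inhabited = let r , Lr = lower-inhabited x
                          s , Ls = lower-inhabited y
                      in r + s - 1ℚ , r , s , Lr , Ls , p-1<p (r + s)
  ; upper-inhabited = let r , Ur = upper-inhabited x
                          s , Us = upper-inhabited y
                      in r + s + 1ℚ , r , s , Ur , Us , p<p+1 (r + s)
  ; lower-closed    = λ p<q (r , s , Lr , Ls , q<r+s) → r , s , Lr , Ls , ℚ.<-trans p<q q<r+s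
  ; upper-closed    = λ p<q (r , s , Ur , Us , r+s<p) → r , s , Ur , Us , ℚ.<-trans r+s<p p<q
  ; lower-open      = λ (r , s , Lr , Ls , p<r+s) →
                      let q , p<q , q<r+s = ℚ.<-dense p<r+s in q , p<q , r , s , Lr , Ls , q<r+s
  ; upper-open      = λ (r , s , Ur , Us , r+s<q) →
                      let p , r+s<p , p<q = ℚ.<-dense r+s<q in p , p<q , r , s , Ur , Us , r+s<p
  ; disjoint        = λ (r , s , Lr , Ls , p<r+s) (r′ , s′ , Ur , Us , r′+s′<p) →
                      ℚ.<-asym (ℚ.<-trans r′+s′<p p<r+s)
                        (ℚ.+-mono-< (lower<upper x Lr Ur) (lower<upper y Ls Us))
  ; located         = locate
  }
  where
  L U : ℚ → Set
  L p = ∃₂ λ r s → lower x r × lower y s × p < r + s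
  U q = ∃₂ λ r s → upper x r × upper y s × r + s < q

  locate : ∀ {p q} → p < q → L p ⊎ U q
  locate {p} {q} p<q = decide (approximate x 0<ε) (approximate y 0<ε)
    where
    ε = (q - p) * ½
    0<ε : 0ℚ < ε
    0<ε = half-pos (<⇒0<- p<q)
    rearrange : ∀ p q r r′ s s′ e →
      q - (r′ + s′) ≡ (p - (r + s)) + ((e - (r′ - r)) + (e - (s′ - s))) + ((q - p) - (e + e))
    rearrange = solve-∀ ℚ-ring
    decide : (∃₂ λ r r′ → lower x r × upper x r′ × r′ - r < ε) →
             (∃₂ λ s s′ → lower y s × upper y s′ × s′ - s < ε) → L p ⊎ U q
    decide (r , r′ , Lr , Ur′ , r′-r<ε) (s , s′ , Ls , Us′ , s′-s<ε) with p ℚ.<? r + s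
    ... | yes p<r+s = inj₁ (r , s , Lr , Ls , p<r+s)
    ... | no  p≮r+s = inj₂ (r′ , s′ , Ur′ , Us′ , 0<-⇒< (rearrange p q r r′ s s′ ε)
      (ℚ.+-mono-<-≤
        (ℚ.+-mono-≤-< (≤⇒0≤- (ℚ.≮⇒≥ p≮r+s)) (+-pos (<⇒0<- r′-r<ε) (<⇒0<- s′-s<ε)))
        (≤⇒0≤- (ℚ.≤-reflexive (p½+p½ (q - p))))))

-ℝ_ : ℝ → ℝ
-ℝ x = record
  { lower           = λ p → upper x (- p)
  ; upper           = λ p → lower x (- p)
  ; lower-inhabited = let q , Uq = upper-inhabited x in - q , subst (upper x) (neg-neg q) Uq
  ; upper-inhabited = let p , Lp = lower-inhabited x in - p , subst (lower x) (neg-neg p) Lp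
  ; lower-closed    = λ p<q → upper-closed x (ℚ.neg-antimono-< p<q)
  ; upper-closed    = λ p<q → lower-closed x (ℚ.neg-antimono-< p<q)
  ; lower-open      = λ {p} U-p → let q , q<-p , Uq = upper-open x U-p
                      in - q , subst (_< - q) (sym (neg-neg p)) (ℚ.neg-antimono-< q<-p) , subst (upper x) (neg-neg q) Uq
  ; upper-open      = λ {p} L-p → let q , -p<q , Lq = lower-open x L-p
                      in - q , subst (- q <_) (sym (neg-neg p)) (ℚ.neg-antimono-< -p<q) , subst (lower x) (neg-neg q) Lq
  ; disjoint        = λ U-p L-p → disjoint x L-p U-p
  ; located         = λ p<q → swap (located x (ℚ.neg-antimono-< p<q))
  }
  where
  neg-neg : ∀ p → p ≡ - (- p)
  neg-neg = solve-∀ ℚ-ring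

_-ℝ_ : ℝ → ℝ → ℝ
x -ℝ y = x +ℝ (-ℝ y)

+ℝ-rawMonoid : RawMonoid _ _
+ℝ-rawMonoid = record { _≈_ = _≃ℝ_ ; _∙_ = _+ℝ_ ; ε = 0ℝ }

-- n ×ℝ x is the product of the natural number n and x, as an n-fold sum.
open RawMonoidDefinitions +ℝ-rawMonoid public using () renaming (_×_ to _×ℝ_)

record Bracket (β : ℝ) : Set where
  constructor bracket
  field
    a a′ b : ℕ
    a/b<β  : lower β (+ a / suc b)
    β<a′/b : upper β (+ a′ / suc b)

-- For rational r > 0 the map t ↦ rᵗ is monotone (increasing if r ≥ 1, decreasing
-- if r ≤ 1), so r^β lies between r^(a/d) and r^(a′/d) whenever a/d < β < a′/d.
-- Hence for x ≥ 0 and β > 0 the real number x^β is the supremum of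
-- min (r^(a/d)) (r^(a′/d)) over rationals 0 < r < x and such brackets of β, and
-- the infimum of max (s^(a/d)) (s^(a′/d)) over rationals s > x.  The cuts below
-- state this with the d-th roots cleared: for p ≥ 0, p < r^(a/d) iff p^d < r^a.
-- The denominator is d = suc b.
module Power (x : ℝ) (0≤x : 0ℝ ≤ℝ x) (β : ℝ) (0<β : 0ℝ <ℝ β) where
  open Bracket

  L U : ℚ → Set
  L p = p < 0ℚ ⊎
        (0ℚ ≤ p × ∃[ r ] Σ[ B ∈ Bracket β ] 0ℚ < r × lower x r ×
                  p ^ suc (b B) < r ^ a B × p ^ suc (b B) < r ^ a′ B)
  U q = 0ℚ < q × ∃[ s ] Σ[ B ∈ Bracket β ] upper x s ×
                  s ^ a B < q ^ suc (b B) × s ^ a′ B < q ^ suc (b B)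

  upper-pos : ∀ {s} → upper x s → 0ℚ < s
  upper-pos Us with ≤⇒upper 0ℝ x 0≤x Us
  ... | 0<s = 0<s

  L-closed : ∀ {p q} → p < q → L q → L p
  L-closed {p} p<q Lq with p ℚ.<? 0ℚ
  ... | yes p<0 = inj₁ p<0
  L-closed {p} p<q (inj₁ q<0) | no p≮0 = inj₁ (ℚ.<-trans p<q q<0)
  L-closed {p} p<q (inj₂ (0≤q , r , B , 0<r , Lr , <a , <a′)) | no p≮0 =
    inj₂ (ℚ.≮⇒≥ p≮0 , r , B , 0<r , Lr , ℚ.≤-<-trans pᵇ≤qᵇ <a , ℚ.≤-<-trans pᵇ≤qᵇ <a′)
    where pᵇ≤qᵇ = ^-monoˡ-≤ (suc (b B)) (ℚ.≮⇒≥ p≮0) (ℚ.<⇒≤ p<q)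

  U-closed : ∀ {p q} → p < q → U p → U q
  U-closed {p} p<q (0<p , s , B , Us , a< , a′<) =
    ℚ.<-trans 0<p p<q , s , B , Us , ℚ.<-≤-trans a< pᵇ≤qᵇ , ℚ.<-≤-trans a′< pᵇ≤qᵇ
    where pᵇ≤qᵇ = ^-monoˡ-≤ (suc (b B)) (ℚ.<⇒≤ 0<p) (ℚ.<⇒≤ p<q)

  L-open : ∀ {p} → L p → ∃[ q ] p < q × L q
  L-open {p} (inj₁ p<0) = let q , p<q , q<0 = ℚ.<-dense p<0 in q , p<q , inj₁ q<0
  L-open {p} (inj₂ (0≤p , r , B , 0<r , Lr , <a , <a′)) =
    widen (∃>^< (suc (b B)) 0≤p <a) (∃>^< (suc (b B)) 0≤p <a′)
    where
    widen : ∃[ q ] p < q × q ^ suc (b B) < r ^ a B →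
            ∃[ q ] p < q × q ^ suc (b B) < r ^ a′ B → ∃[ q ] p < q × L q
    widen (q , p<q , q<) (q′ , p<q′ , q′<) with ℚ.≤-total q q′
    ... | inj₁ q≤q′ = q , p<q , inj₂ (0≤q , r , B , 0<r , Lr , q< ,
            ℚ.≤-<-trans (^-monoˡ-≤ (suc (b B)) 0≤q q≤q′) q′<)
      where 0≤q = ℚ.≤-trans 0≤p (ℚ.<⇒≤ p<q)
    ... | inj₂ q′≤q = q′ , p<q′ , inj₂ (0≤q′ , r , B , 0<r , Lr ,
            ℚ.≤-<-trans (^-monoˡ-≤ (suc (b B)) 0≤q′ q′≤q) q< , q′<)
      where 0≤q′ = ℚ.≤-trans 0≤p (ℚ.<⇒≤ p<q′)

  U-open : ∀ {q} → U q → ∃[ p ] p < q × U p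
  U-open {q} (0<q , s , B , Us , a< , a′<) =
    narrow (∃<<^ (suc (b B)) 0<q a<) (∃<<^ (suc (b B)) 0<q a′<)
    where
    narrow : ∃[ p ] 0ℚ < p × p < q × s ^ a B < p ^ suc (b B) →
             ∃[ p ] 0ℚ < p × p < q × s ^ a′ B < p ^ suc (b B) → ∃[ p ] p < q × U p
    narrow (p , 0<p , p<q , <p) (p′ , 0<p′ , p′<q , <p′) with ℚ.≤-total p p′
    ... | inj₁ p≤p′ = p′ , p′<q , 0<p′ , s , B , Us ,
            ℚ.<-≤-trans <p (^-monoˡ-≤ (suc (b B)) (ℚ.<⇒≤ 0<p) p≤p′) , <p′
    ... | inj₂ p′≤p = p , p<q , 0<p , s , B , Us , <p ,
            ℚ.<-≤-trans <p′ (^-monoˡ-≤ (suc (b B)) (ℚ.<⇒≤ 0<p′) p′≤p)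

  bracket< : (B C : Bracket β) → a B ℕ.* suc (b C) ℕ.≤ a′ C ℕ.* suc (b B)
  bracket< B C = ℕ.<⇒≤ (frac<⇒ (a B) (b B) (a′ C) (b C) (lower<upper β (a/b<β B) (β<a′/b C)))

  disjointPower : ∀ {p} → L p → ¬ U p
  disjointPower (inj₁ p<0) (0<p , _) = ℚ.<-asym p<0 0<p
  disjointPower {p} (inj₂ (0≤p , r , B , 0<r , Lr , <a , <a′)) (0<p , s , C , Us , c< , c′<) =
    compare (ℚ.≤-total 1ℚ r)
    where
    r≤s : r ≤ s
    r≤s = ℚ.<⇒≤ (lower<upper x Lr Us)
    0≤r = ℚ.<⇒≤ 0<r
    clash : ∀ {i j} → p ^ suc (b B) < r ^ i → s ^ j < p ^ suc (b C) →
            ¬ (r ^ (i ℕ.* suc (b C)) ≤ r ^ (j ℕ.* suc (b B)))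
    clash {i} {j} p<rⁱ sʲ<p r≤r = ℚ.<-irrefl refl (begin-strict
      p ^ (suc (b B) ℕ.* suc (b C))  ≡⟨ ^-assocʳ p (suc (b B)) (suc (b C)) ⟨
      (p ^ suc (b B)) ^ suc (b C)    <⟨ ^-monoˡ-< (b C) (^-nonneg (suc (b B)) 0≤p) p<rⁱ ⟩
      (r ^ i) ^ suc (b C)            ≡⟨ ^-assocʳ r i (suc (b C)) ⟩
      r ^ (i ℕ.* suc (b C))          ≤⟨ r≤r ⟩
      r ^ (j ℕ.* suc (b B))          ≤⟨ ^-monoˡ-≤ (j ℕ.* suc (b B)) 0≤r r≤s ⟩
      s ^ (j ℕ.* suc (b B))          ≡⟨ ^-assocʳ s j (suc (b B)) ⟨
      (s ^ j) ^ suc (b B)            <⟨ ^-monoˡ-< (b B) (^-nonneg j (ℚ.≤-trans 0≤r r≤s)) sʲ<p ⟩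
      (p ^ suc (b C)) ^ suc (b B)    ≡⟨ ^-assocʳ p (suc (b C)) (suc (b B)) ⟩
      p ^ (suc (b C) ℕ.* suc (b B))  ≡⟨ cong (p ^_) (ℕ.*-comm (suc (b C)) (suc (b B))) ⟩
      p ^ (suc (b B) ℕ.* suc (b C))  ∎)
      where open ℚ.≤-Reasoning
    compare : ¬ (1ℚ ≤ r ⊎ r ≤ 1ℚ)
    compare (inj₁ 1≤r) = clash {a B} {a′ C} <a c′< (^-monoʳ-≤ 1≤r (bracket< B C))
    compare (inj₂ r≤1) = clash {a′ B} {a C} <a′ c< (^-antimonoʳ-≤ 0≤r r≤1 (bracket< C B))

  bracketOfWidth2 : ∀ b → Σ[ B ∈ Bracket β ] Bracket.b B ≡ b × a′ B ≡ 2 ℕ.+ a B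
  bracketOfWidth2 b = start (upper-inhabited β)
    where
    Result = Σ[ B ∈ Bracket β ] Bracket.b B ≡ b × a′ B ≡ 2 ℕ.+ a B
    0/b<β : lower β (+ 0 / suc b)
    0/b<β = let q , 0<q , Lq = 0<β in
      lower-closed β (subst (_< q) (sym (ℚ.0/n≡0 (suc b))) 0<q) Lq
    walk : ∀ n i → lower β (+ i / suc b) → upper β (+ (n ℕ.+ i) / suc b) → Result
    walk zero i Li Ui = contradiction Ui (disjoint β Li)
    walk (suc n) i Li U with located β (frac<⇐ (suc i) b (2 ℕ.+ i) b
                                      (ℕ.*-monoˡ-< (suc b) (ℕ.n<1+n (suc i))))
    ... | inj₁ L = walk n (suc i) L (subst (λ k → upper β (+ k / suc b)) (sym (ℕ.+-suc n i)) U)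
    ... | inj₂ V = bracket i (2 ℕ.+ i) b Li V , refl , refl
    start : ∃[ q ] upper β q → Result
    start (q , Uq) = reach (<frac q b)
      where
      reach : ∃[ n ] q < + n / suc b → Result
      reach (n , q<n/b) = walk n 0 0/b<β (subst (λ k → upper β (+ k / suc b))
        (sym (ℕ.+-identityʳ n)) (upper-closed β q<n/b Uq))

  bracketFrom1 : Σ[ B ∈ Bracket β ] 1 ℕ.≤ a B × 1 ℕ.≤ a′ B
  bracketFrom1 = start 0<β (upper-inhabited β)
    where
    start : ∃[ p ] 0ℚ < p × lower β p → ∃[ q ] upper β q →
            Σ[ B ∈ Bracket β ] 1 ℕ.≤ a B × 1 ℕ.≤ a′ B
    start (p , 0<p , Lp) (q , Uq) = build (1/< 0<p)
      where
      build : ∃[ b ] + 1 / suc b < p → Σ[ B ∈ Bracket β ] 1 ℕ.≤ a B × 1 ℕ.≤ a′ B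
      build (b , 1/b<p) = cap (<frac q b)
        where
        L1/b = lower-closed β 1/b<p Lp
        cap : ∃[ n ] q < + n / suc b → Σ[ B ∈ Bracket β ] 1 ℕ.≤ a B × 1 ℕ.≤ a′ B
        cap (n , q<n/b) = bracket 1 n b L1/b Un/b , ℕ.≤-refl , 1≤n
          where
          Un/b = upper-closed β q<n/b Uq
          1≤n : 1 ℕ.≤ n
          1≤n = ℕ.<⇒≤ (ℕ.*-cancelʳ-< (suc b) 1 n
            (frac<⇒ 1 b n b (lower<upper β L1/b Un/b)))

  -- Locatedness when x is bounded away from 0.  For a large denominator n the
  -- ratio q^n / p^n exceeds M, whereas for ρ ≤ r < x < s ≤ S with r and s close
  -- together s^j ≤ M r^i for all i, j ∈ {a , a + 2}; so p^n < r^i for both i, or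
  -- s^j < q^n for both j.
  module _ {ρ S p q : ℚ} (0<ρ : 0ℚ < ρ) (1≤S : 1ℚ ≤ S) (Lρ : lower x ρ) (US : upper x S)
           (0<p : 0ℚ < p) (p<q : p < q) where
    κ = proj₁ (inverse 0<ρ)
    0<κ = proj₁ (proj₂ (inverse 0<ρ))
    ρκ≡1 : ρ * κ ≡ 1ℚ
    ρκ≡1 = proj₂ (proj₂ (inverse 0<ρ))
    0≤S : 0ℚ ≤ S
    0≤S = ℚ.≤-trans (ℚ.<⇒≤ 0<1) 1≤S
    T = S + κ
    0≤T : 0ℚ ≤ T
    0≤T = +-nonneg 0≤S (ℚ.<⇒≤ 0<κ)
    S≤T : S ≤ T
    S≤T = subst (_≤ T) (ℚ.+-identityʳ S) (ℚ.+-monoʳ-≤ S (ℚ.<⇒≤ 0<κ))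
    κ≤T : κ ≤ T
    κ≤T = subst (_≤ T) (ℚ.+-identityˡ κ) (ℚ.+-monoˡ-≤ κ 0≤S)
    M = (T * T) * (1ℚ + 1ℚ)

    1≤TT : 1ℚ ≤ T * T
    1≤TT = *-mono (ℚ.<⇒≤ 0<1) (ℚ.≤-trans 1≤S S≤T) (ℚ.<⇒≤ 0<1) (ℚ.≤-trans 1≤S S≤T)

    same : ∀ i r → 0ℚ ≤ r → r ^ i ≤ r ^ i * (T * T)
    same i r 0≤r = subst (_≤ r ^ i * (T * T)) (ℚ.*-identityʳ (r ^ i)) (*-monoˡ (^-nonneg i 0≤r) 1≤TT)

    up : ∀ i r → 0ℚ ≤ r → r ≤ S → r ^ (2 ℕ.+ i) ≤ r ^ i * (T * T)
    up i r 0≤r r≤S = subst (_≤ r ^ i * (T * T)) (commute r (r ^ i))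
      (*-monoˡ (^-nonneg i 0≤r) (*-mono 0≤r r≤T 0≤r r≤T))
      where
      r≤T = ℚ.≤-trans r≤S S≤T
      commute : ∀ r c → c * (r * r) ≡ r * (r * c)
      commute = solve-∀ ℚ-ring

    down : ∀ i r → ρ ≤ r → r ^ i ≤ r ^ (2 ℕ.+ i) * (T * T)
    down i r ρ≤r = subst₂ _≤_ (ℚ.*-identityʳ (r ^ i)) (commute r T (r ^ i))
      (*-monoˡ (^-nonneg i 0≤r) (*-mono (ℚ.<⇒≤ 0<1) 1≤rT (ℚ.<⇒≤ 0<1) 1≤rT))
      where
      0≤r = ℚ.≤-trans (ℚ.<⇒≤ 0<ρ) ρ≤r
      1≤rT : 1ℚ ≤ r * T
      1≤rT = subst (_≤ r * T) ρκ≡1 (*-mono (ℚ.<⇒≤ 0<ρ) ρ≤r (ℚ.<⇒≤ 0<κ) κ≤T)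
      commute : ∀ r t c → c * ((r * t) * (r * t)) ≡ r * (r * c) * (t * t)
      commute = solve-∀ ℚ-ring

    Doubling : ℕ → ℚ → Set
    Doubling j ε = ∀ {r s} → ρ ≤ r → r ≤ s → s ≤ S → s - r < ε → s ^ j ≤ r ^ j * (1ℚ + 1ℚ)

    doubling : ∀ j → ∃[ ε ] 0ℚ < ε × Doubling j ε
    doubling j = finish (∃ε*c< 0≤c (^-pos j 0<ρ))
      where
      c = lipschitz S j
      0≤c : 0ℚ ≤ c
      0≤c = lipschitz-nonneg j 0≤S
      double : ∀ c → c + c ≡ c * (1ℚ + 1ℚ)
      double = solve-∀ ℚ-ring
      finish : ∃[ ε ] 0ℚ < ε × ε * c < ρ ^ j → ∃[ ε ] 0ℚ < ε × Doubling j ε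
      finish (ε , 0<ε , εc<ρʲ) = ε , 0<ε , λ {r} {s} ρ≤r r≤s s≤S s-r<ε → begin
        s ^ j                ≤⟨ ^-lipschitz j (ℚ.≤-trans (ℚ.<⇒≤ 0<ρ) ρ≤r) r≤s s≤S ⟩
        r ^ j + (s - r) * c  ≤⟨ ℚ.+-monoʳ-≤ (r ^ j) (*-monoʳ 0≤c (ℚ.<⇒≤ s-r<ε)) ⟩
        r ^ j + ε * c        ≤⟨ ℚ.+-monoʳ-≤ (r ^ j) (ℚ.<⇒≤ εc<ρʲ) ⟩
        r ^ j + ρ ^ j        ≤⟨ ℚ.+-monoʳ-≤ (r ^ j) (^-monoˡ-≤ j (ℚ.<⇒≤ 0<ρ) ρ≤r) ⟩
        r ^ j + r ^ j        ≡⟨ double (r ^ j) ⟩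
        r ^ j * (1ℚ + 1ℚ)    ∎
        where open ℚ.≤-Reasoning

    noGap : ∀ i j n r s → p ^ suc n * M < q ^ suc n →
            ¬ (p ^ suc n < r ^ i) → ¬ (s ^ j < q ^ suc n) →
            s ^ j ≤ r ^ j * (1ℚ + 1ℚ) → ¬ (r ^ j ≤ r ^ i * (T * T))
    noGap i j n r s gap p≮r s≮q s≤2r r≤rTT = ℚ.<-irrefl refl (begin-strict
      p ^ suc n * M                   <⟨ gap ⟩
      q ^ suc n                       ≤⟨ ℚ.≮⇒≥ s≮q ⟩
      s ^ j                           ≤⟨ s≤2r ⟩
      r ^ j * (1ℚ + 1ℚ)               ≤⟨ *-monoʳ 0≤2 r≤rTT ⟩
      r ^ i * (T * T) * (1ℚ + 1ℚ)     ≡⟨ ℚ.*-assoc (r ^ i) (T * T) (1ℚ + 1ℚ) ⟩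
      r ^ i * M                       ≤⟨ *-monoʳ 0≤M (ℚ.≮⇒≥ p≮r) ⟩
      p ^ suc n * M                   ∎)
      where
      open ℚ.≤-Reasoning
      0≤2 : 0ℚ ≤ 1ℚ + 1ℚ
      0≤2 = +-nonneg (ℚ.<⇒≤ 0<1) (ℚ.<⇒≤ 0<1)
      0≤M : 0ℚ ≤ M
      0≤M = *-nonneg (*-nonneg 0≤T 0≤T) 0≤2

    locateAway : L p ⊎ U q
    locateAway = choose-b (∃^*<^ M 0<p p<q)
      where
      choose-b : ∃[ n ] p ^ suc n * M < q ^ suc n → L p ⊎ U q
      choose-b (n , gap) = choose-a (bracketOfWidth2 n)
        where
        choose-a : Σ[ B ∈ Bracket β ] b B ≡ n × a′ B ≡ 2 ℕ.+ a B → L p ⊎ U q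
        choose-a (B@(bracket i _ _ _ _) , refl , refl) = choose-ε (doubling i) (doubling (2 ℕ.+ i))
          where
          choose-ε : ∃[ ε ] 0ℚ < ε × Doubling i ε → ∃[ ε ] 0ℚ < ε × Doubling (2 ℕ.+ i) ε → L p ⊎ U q
          choose-ε (ε , 0<ε , double) (ε′ , 0<ε′ , double′) = choose-δ (∃<₂ 0<ε 0<ε′)
            where
            choose-δ : ∃[ δ ] 0ℚ < δ × δ < ε × δ < ε′ → L p ⊎ U q
            choose-δ (δ , 0<δ , δ<ε , δ<ε′) = choose-rs (approximate-within x Lρ US 0<δ)
              where
              choose-rs : (∃₂ λ r s → lower x r × upper x s × ρ ≤ r × s ≤ S × s - r < δ) → L p ⊎ U q
              choose-rs (r , s , Lr , Us , ρ≤r , s≤S , s-r<δ) = decide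
                (p ^ suc n ℚ.<? r ^ i) (p ^ suc n ℚ.<? r ^ (2 ℕ.+ i))
                (s ^ i ℚ.<? q ^ suc n) (s ^ (2 ℕ.+ i) ℚ.<? q ^ suc n)
                where
                0≤r = ℚ.≤-trans (ℚ.<⇒≤ 0<ρ) ρ≤r
                r≤s = ℚ.<⇒≤ (lower<upper x Lr Us)
                sⁱ≤   = double  ρ≤r r≤s s≤S (ℚ.<-trans s-r<δ δ<ε)
                s²⁺ⁱ≤ = double′ ρ≤r r≤s s≤S (ℚ.<-trans s-r<δ δ<ε′)
                decide : Dec (p ^ suc n < r ^ i) → Dec (p ^ suc n < r ^ (2 ℕ.+ i)) →
                         Dec (s ^ i < q ^ suc n) → Dec (s ^ (2 ℕ.+ i) < q ^ suc n) → L p ⊎ U q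
                decide (yes l) (yes l′) _ _ =
                  inj₁ (inj₂ (ℚ.<⇒≤ 0<p , r , B , ℚ.<-≤-trans 0<ρ ρ≤r , Lr , l , l′))
                decide _ _ (yes u) (yes u′) = inj₂ (ℚ.<-trans 0<p p<q , s , B , Us , u , u′)
                decide (no l) _ (no u) _ =
                  contradiction (same i r 0≤r) (noGap i i n r s gap l u sⁱ≤)
                decide (no l) _ (yes _) (no u) =
                  contradiction (up i r 0≤r (ℚ.≤-trans r≤s s≤S)) (noGap i (2 ℕ.+ i) n r s gap l u s²⁺ⁱ≤)
                decide (yes _) (no l) (no u) _ =
                  contradiction (down i r ρ≤r) (noGap (2 ℕ.+ i) i n r s gap l u sⁱ≤)
                decide (yes _) (no l) (yes _) (no u) =
                  contradiction (same (2 ℕ.+ i) r 0≤r) (noGap (2 ℕ.+ i) (2 ℕ.+ i) n r s gap l u s²⁺ⁱ≤)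

  locate⁺ : ∀ {p q} → 0ℚ < p → p < q → L p ⊎ U q
  locate⁺ {p} {q} 0<p p<q = split bracketFrom1
    where
    0<q = ℚ.<-trans 0<p p<q
    split : Σ[ B ∈ Bracket β ] 1 ℕ.≤ a B × 1 ℕ.≤ a′ B → L p ⊎ U q
    split (B , 1≤a , 1≤a′) = at (∃<₂ 0<1 (^-pos (suc (b B)) 0<q))
      where
      at : ∃[ σ ] 0ℚ < σ × σ < 1ℚ × σ < q ^ suc (b B) → L p ⊎ U q
      at (σ , 0<σ , σ<1 , σ<qᵇ) = side (located x (half< 0<σ)) (upper-inhabited x)
        where
        small : ∀ {k} → 1 ℕ.≤ k → σ ^ k < q ^ suc (b B)
        small {k} 1≤k = ℚ.≤-<-trans (subst (σ ^ k ≤_) (ℚ.*-identityʳ σ)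
          (^-antimonoʳ-≤ (ℚ.<⇒≤ 0<σ) (ℚ.<⇒≤ σ<1) 1≤k)) σ<qᵇ
        side : lower x (σ * ½) ⊎ upper x σ → ∃[ S ] upper x S → L p ⊎ U q
        side (inj₂ Uσ) _        = inj₂ (0<q , σ , B , Uσ , small 1≤a , small 1≤a′)
        side (inj₁ Lρ) (S , US) = locateAway (half-pos 0<σ) 1≤S+1 Lρ (upper-closed x (p<p+1 S) US) 0<p p<q
          where
          1≤S+1 : 1ℚ ≤ S + 1ℚ
          1≤S+1 = subst (_≤ S + 1ℚ) (ℚ.+-identityˡ 1ℚ) (ℚ.+-monoˡ-≤ 1ℚ (ℚ.<⇒≤ (upper-pos US)))

  locate : ∀ {p q} → p < q → L p ⊎ U q
  locate {p} {q} p<q with p ℚ.<? 0ℚ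
  ... | yes p<0 = inj₁ (inj₁ p<0)
  ... | no  p≮0 = between (ℚ.<-dense p<q)
    where
    between : ∃[ m ] p < m × m < q → L p ⊎ U q
    between (m , p<m , m<q) = map₁ (L-closed p<m) (locate⁺ (ℚ.≤-<-trans (ℚ.≮⇒≥ p≮0) p<m) m<q)

  U-inhabited : ∃[ q ] U q
  U-inhabited = build (upper-inhabited x) bracketFrom1
    where
    build : ∃[ s ] upper x s → Σ[ B ∈ Bracket β ] 1 ℕ.≤ a B × 1 ℕ.≤ a′ B → ∃[ q ] U q
    build (s , Us) (B , _) = q , 0<q , s , B , Us ,
      ℚ.<-≤-trans (0<-⇒< (rearrange₁ u v) (+-pos 0<v 0<1)) q≤qᵇ ,
      ℚ.<-≤-trans (0<-⇒< (rearrange₂ u v) (+-pos 0<u 0<1)) q≤qᵇ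
      where
      u = s ^ a B
      v = s ^ a′ B
      q = u + v + 1ℚ
      0<u : 0ℚ < u
      0<u = ^-pos (a B) (upper-pos Us)
      0<v : 0ℚ < v
      0<v = ^-pos (a′ B) (upper-pos Us)
      0<q : 0ℚ < q
      0<q = +-pos (+-pos 0<u 0<v) 0<1
      1≤q : 1ℚ ≤ q
      1≤q = ℚ.<⇒≤ (0<-⇒< (rearrange₃ u v) (+-pos 0<u 0<v))
        where
        rearrange₃ : ∀ u v → u + v + 1ℚ - 1ℚ ≡ u + v
        rearrange₃ = solve-∀ ℚ-ring
      q≤qᵇ : q ≤ q ^ suc (b B)
      q≤qᵇ = subst (_≤ q ^ suc (b B)) (ℚ.*-identityʳ q) (*-monoˡ (ℚ.<⇒≤ 0<q) (1≤^ (b B) 1≤q))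
      rearrange₁ : ∀ u v → u + v + 1ℚ - u ≡ v + 1ℚ
      rearrange₁ = solve-∀ ℚ-ring
      rearrange₂ : ∀ u v → u + v + 1ℚ - v ≡ u + 1ℚ
      rearrange₂ = solve-∀ ℚ-ring

  power : ℝ
  power = record
    { lower           = L
    ; upper           = U
    ; lower-inhabited = 0ℚ - 1ℚ , inj₁ (p-1<p 0ℚ)
    ; upper-inhabited = U-inhabited
    ; lower-closed    = L-closed
    ; upper-closed    = U-closed
    ; lower-open      = L-open
    ; upper-open      = U-open
    ; disjoint        = disjointPower
    ; located         = locate
    }

record RealFunction : Set₁ where
  field
    domain      : ℝ → Set
    domain-resp : ∀ {x y} → x ≃ℝ y → domain x → domain y
    value       : ∀ x → domain x → ℝ
    value-cong  : ∀ {x y} (dx : domain x) (dy : domain y) → x ≃ℝ y → value x dx ≃ℝ value y dy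

open RealFunction public

powerFunction : (β : ℝ) → 0ℝ <ℝ β → RealFunction
powerFunction β 0<β = record
  { domain      = λ x → 0ℝ ≤ℝ x
  ; domain-resp = λ (x≤y , _) 0≤x q Lq → x≤y q (0≤x q Lq)
  ; value       = λ x 0≤x → Power.power x 0≤x β 0<β
  ; value-cong  = λ {x} {y} 0≤x 0≤y (x≤y , y≤x) → monotone x y x≤y 0≤x 0≤y , monotone y x y≤x 0≤y 0≤x
  }
  where
  monotone : ∀ x y → x ≤ℝ y → ∀ 0≤x 0≤y → Power.power x 0≤x β 0<β ≤ℝ Power.power y 0≤y β 0<β
  monotone x y x≤y 0≤x 0≤y p (inj₁ p<0) = inj₁ p<0
  monotone x y x≤y 0≤x 0≤y p (inj₂ (0≤p , r , B , 0<r , Lr , ls)) =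
    inj₂ (0≤p , r , B , 0<r , x≤y r Lr , ls)

-- The subtractions k ∸ 2 and k ∸ 1 are exact because k ≥ 3.
record _∈𝓕 (f : RealFunction) : Set where
  field
    ℕ⊆domain : ∀ k → domain f (fromℕ k)

  at : ℕ → ℝ
  at k = value f (fromℕ k) (ℕ⊆domain k)

  field
    at0≃0      : at 0 ≃ℝ 0ℝ
    convex     : ∀ k → at (2 ℕ.+ k) -ℝ at (1 ℕ.+ k) >ℝ at (1 ℕ.+ k) -ℝ at k
    inequality : ∀ k → 3 ℕ.≤ k → (k ℕ.∸ 2) ×ℝ at k ≥ℝ k ×ℝ (at (k ℕ.∸ 1) -ℝ at 1)

2≤⇒0< : ∀ {β} → β ≥ℝ fromℕ 2 → 0ℝ <ℝ β
2≤⇒0< 2≤β = 1ℚ , 0<1 , 2≤β 1ℚ (frac<⇐ 1 0 2 0 ℕ.≤-refl)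

{-# OPTIONS --safe #-}
module Submission where

-- Order of reals is tested on rational bounds of the powers involved.  Any finite set of
-- bounds i^β < u and l < j^β survives replacing β by one rational exponent a / d > β ≥ 2,
-- after which i^a ≤ u^d and l^d ≤ j^a, and everything follows from weighted AM-GM, i.e.
-- Bernoulli's inequality for rational exponents ≥ 1.  With n = k - 1 the inequality
-- (k - 2) k^β + k ≥ k (k - 1)^β is convexity of x ↦ x^(β-1) at the points n + 1 and 1 with
-- weights (n - 1) / n and 1 / n, whose mean is n.  For strict convexity with m = k + 1,
-- Bernoulli's inequality with exponent β / 2 at (1 ± 1/m)² gives
-- (m + 1)^β + (m - 1)^β - 2 m^β ≥ β m^(β-2), bounded below by the rational 2 / m².

open import Defs
open import Algebra.Bundles using (CommutativeRing)
import Data.Integer.Base as ℤ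
open import Data.Nat.Base as ℕ using (ℕ; zero; suc)
import Data.Nat.Properties as ℕ
open import Data.Product.Base using (∃₂; ∃-syntax; _×_; _,_; proj₁)
open import Data.Rational.Base as ℚ using (ℚ; 0ℚ; 1ℚ; ½; _+_; _*_; _-_; -_; _<_; _≤_; _/_; +-*-rawSemiring)
import Data.Rational.Properties as ℚ
open import Data.Sum.Base using (inj₁; inj₂)
open import Relation.Binary.PropositionalEquality using (_≡_; refl; sym; trans; cong; cong₂; subst; subst₂; module ≡-Reasoning)
open import Relation.Nullary using (¬_; contradiction)
open import Tactic.RingSolver using (solve-∀)

open import Algebra.Definitions.RawSemiring +-*-rawSemiring using (_^_)
open import Algebra.Properties.CommutativeSemiring.Exp (CommutativeRing.commutativeSemiring ℚ.+-*-commutativeRing) using (^-homo-*; ^-distrib-*; ^-assocʳ)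

open RationalLemmas
open Cuts

-- Natural numbers as rationals, and cancellation.

⟦_⟧ : ℕ → ℚ
⟦ n ⟧ = ℤ.+ n / 1

⟦⟧-homo-+ : ∀ m n → ⟦ m ℕ.+ n ⟧ ≡ ⟦ m ⟧ + ⟦ n ⟧
⟦⟧-homo-+ zero    n = sym (ℚ.+-identityˡ ⟦ n ⟧)
⟦⟧-homo-+ (suc m) n = begin
  ⟦ suc (m ℕ.+ n) ⟧       ≡⟨ 1+n/1 (m ℕ.+ n) ⟩
  1ℚ + ⟦ m ℕ.+ n ⟧        ≡⟨ cong (1ℚ +_) (⟦⟧-homo-+ m n) ⟩
  1ℚ + (⟦ m ⟧ + ⟦ n ⟧)    ≡⟨ ℚ.+-assoc 1ℚ ⟦ m ⟧ ⟦ n ⟧ ⟨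
  1ℚ + ⟦ m ⟧ + ⟦ n ⟧      ≡⟨ cong (_+ ⟦ n ⟧) (1+n/1 m) ⟨
  ⟦ suc m ⟧ + ⟦ n ⟧       ∎
  where open ≡-Reasoning

0≤⟦⟧ : ∀ n → 0ℚ ≤ ⟦ n ⟧
0≤⟦⟧ zero    = ℚ.≤-refl
0≤⟦⟧ (suc n) = subst (0ℚ ≤_) (sym (1+n/1 n)) (+-nonneg (ℚ.<⇒≤ 0<1) (0≤⟦⟧ n))

1≤⟦suc⟧ : ∀ n → 1ℚ ≤ ⟦ suc n ⟧
1≤⟦suc⟧ n = subst₂ _≤_ (ℚ.+-identityʳ 1ℚ) (sym (1+n/1 n)) (ℚ.+-monoʳ-≤ 1ℚ (0≤⟦⟧ n))

0<⟦suc⟧ : ∀ n → 0ℚ < ⟦ suc n ⟧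
0<⟦suc⟧ n = ℚ.<-≤-trans 0<1 (1≤⟦suc⟧ n)

*-cancelˡ : ∀ {p q r} → 0ℚ < r → r * p ≤ r * q → p ≤ q
*-cancelˡ {r = r} 0<r = ℚ.*-cancelˡ-≤-pos r {{ℚ.positive 0<r}}

0<⟦nonZero⟧ : ∀ n .{{_ : ℕ.NonZero n}} → 0ℚ < ⟦ n ⟧
0<⟦nonZero⟧ (suc n) = 0<⟦suc⟧ n

+suc-nonZero : ∀ c {d} → ℕ.NonZero (c ℕ.+ suc d)
+suc-nonZero zero    = _
+suc-nonZero (suc c) = _

^-cancel-≤ : ∀ {p q} n .{{_ : ℕ.NonZero n}} → 0ℚ ≤ q → p ^ n ≤ q ^ n → p ≤ q
^-cancel-≤ (suc n) 0≤q pⁿ≤qⁿ = ℚ.≮⇒≥ (λ q<p → ℚ.<-irrefl refl (ℚ.<-≤-trans (^-monoˡ-< n 0≤q q<p) pⁿ≤qⁿ))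

-- Bernoulli's inequality and weighted AM-GM.

-- Induction on `n`: the gap between the two sides for `suc n` is `x` times the gap for `n` plus
-- `⟦ suc n ⟧ * y ^ n` times the square of `x - y`.
bernoulli-homogeneous : ∀ {x y} n → 0ℚ ≤ x → 0ℚ ≤ y →
                        ⟦ suc n ⟧ * (x * y ^ n) ≤ x ^ suc n + ⟦ n ⟧ * y ^ suc n
bernoulli-homogeneous {x} {y} zero _ _ = ℚ.≤-reflexive (lemma x y)
  where
  lemma : ∀ x y → 1ℚ * (x * 1ℚ) ≡ x * 1ℚ + 0ℚ * (y * 1ℚ)
  lemma = solve-∀ ℚ-ring
bernoulli-homogeneous {x} {y} (suc n) 0≤x 0≤y = 0≤-⇒≤
  (trans
    (cong₂ (λ s t → x * x ^ suc n + t * (y * y ^ suc n) - s * (x * y ^ suc n))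
      (trans (1+n/1 (suc n)) (cong (1ℚ +_) (1+n/1 n))) (1+n/1 n))
    (trans (lemma x y ⟦ n ⟧ (x ^ suc n) (y ^ n))
      (cong (λ s → x * (x ^ suc n + ⟦ n ⟧ * y ^ suc n - s * (x * y ^ n)) +
                   s * (y ^ n * ((x - y) * (x - y)))) (sym (1+n/1 n)))))
  (+-nonneg
    (*-nonneg 0≤x (≤⇒0≤- (bernoulli-homogeneous n 0≤x 0≤y)))
    (*-nonneg (0≤⟦⟧ (suc n)) (*-nonneg (^-nonneg n 0≤y) (square-nonneg (x - y)))))
  where
  lemma : ∀ x y n a b →
    x * a + (1ℚ + n) * (y * (y * b)) - (1ℚ + (1ℚ + n)) * (x * (y * b)) ≡
    x * (a + n * (y * b) - (1ℚ + n) * (x * b)) + (1ℚ + n) * (b * ((x - y) * (x - y)))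
  lemma = solve-∀ ℚ-ring
  square-nonneg : ∀ p → 0ℚ ≤ p * p
  square-nonneg p with ℚ.≤-total 0ℚ p
  ... | inj₁ 0≤p = *-nonneg 0≤p 0≤p
  ... | inj₂ p≤0 = subst (0ℚ ≤_) (neg*neg p) (*-nonneg 0≤-p 0≤-p)
    where
    0≤-p = ℚ.neg-antimono-≤ p≤0
    neg*neg : ∀ p → (- p) * (- p) ≡ p * p
    neg*neg = solve-∀ ℚ-ring

-- Induction step of AM-GM: `A′` is the mean after `l` joins `n` numbers of mean `A`. Solving the
-- mean equation for `l` turns the claim into `bernoulli-homogeneous` at `A′` and `A`.
mean-step : ∀ {A A′ l} n → 0ℚ ≤ A → 0ℚ ≤ A′ → ⟦ suc n ⟧ * A′ ≡ ⟦ n ⟧ * A + l →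
            l * A ^ n ≤ A′ ^ suc n
mean-step {A} {A′} {l} n 0≤A 0≤A′ mean = 0≤-⇒≤
  (trans (cong (λ z → A′ ^ suc n - z * A ^ n) l≡)
    (lemma (A′ ^ suc n) (A ^ n) ⟦ n ⟧ ⟦ suc n ⟧ A A′))
  (≤⇒0≤- (bernoulli-homogeneous n 0≤A′ 0≤A))
  where
  cancel : ∀ a l → l ≡ a + l - a
  cancel = solve-∀ ℚ-ring
  l≡ : l ≡ ⟦ suc n ⟧ * A′ - ⟦ n ⟧ * A
  l≡ = trans (cancel (⟦ n ⟧ * A) l) (cong (_- ⟦ n ⟧ * A) (sym mean))
  lemma : ∀ p a n s A A′ → p - (s * A′ - n * A) * a ≡ p + n * (A * a) - s * (A′ * a)
  lemma = solve-∀ ℚ-ring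

mean : ∀ n .{{_ : ℕ.NonZero n}} {s} → 0ℚ ≤ s → ∃[ A ] 0ℚ ≤ A × ⟦ n ⟧ * A ≡ s
mean n {s} 0≤s with inverse (0<⟦nonZero⟧ n)
... | r , 0<r , nr≡1 = s * r , *-nonneg 0≤s (ℚ.<⇒≤ 0<r) ,
  trans (lemma ⟦ n ⟧ s r) (trans (cong (s *_) nr≡1) (ℚ.*-identityʳ s))
  where
  lemma : ∀ n s r → n * (s * r) ≡ s * (n * r)
  lemma = solve-∀ ℚ-ring

-- Start from `suc d` copies of `u` and add the copies of `l` one at a time by `mean-step`. The
-- weight of `u` is a successor, so each intermediate mean exists.
weighted-AM-GM : ∀ c d {l u A} → 0ℚ ≤ l → 0ℚ ≤ u → 0ℚ ≤ A →
                 ⟦ c ℕ.+ suc d ⟧ * A ≡ ⟦ c ⟧ * l + ⟦ suc d ⟧ * u →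
                 l ^ c * u ^ suc d ≤ A ^ (c ℕ.+ suc d)
weighted-AM-GM zero d {l} {u} {A} 0≤l 0≤u 0≤A eq =
  ℚ.≤-trans (ℚ.≤-reflexive (ℚ.*-identityˡ (u ^ suc d)))
    (^-monoˡ-≤ (suc d) 0≤u (*-cancelˡ (0<⟦suc⟧ d) (ℚ.≤-reflexive (trans (lemma l (⟦ suc d ⟧ * u)) (sym eq)))))
  where
  lemma : ∀ l z → z ≡ 0ℚ * l + z
  lemma = solve-∀ ℚ-ring
weighted-AM-GM (suc c) d {l} {u} {A′} 0≤l 0≤u 0≤A′ eq = extend (mean n {{+suc-nonZero c}} 0≤s)
  where
  n = c ℕ.+ suc d
  s = ⟦ c ⟧ * l + ⟦ suc d ⟧ * u
  0≤s : 0ℚ ≤ s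
  0≤s = +-nonneg (*-nonneg (0≤⟦⟧ c) 0≤l) (*-nonneg (0≤⟦⟧ (suc d)) 0≤u)
  lemma : ∀ c l v → (1ℚ + c) * l + v ≡ c * l + v + l
  lemma = solve-∀ ℚ-ring
  extend : ∃[ A ] 0ℚ ≤ A × ⟦ n ⟧ * A ≡ s → l ^ suc c * u ^ suc d ≤ A′ ^ suc n
  extend (A , 0≤A , nA≡s) = begin
    l * l ^ c * u ^ suc d    ≡⟨ ℚ.*-assoc l (l ^ c) (u ^ suc d) ⟩
    l * (l ^ c * u ^ suc d)  ≤⟨ *-monoˡ 0≤l (weighted-AM-GM c d 0≤l 0≤u 0≤A nA≡s) ⟩
    l * A ^ n                ≤⟨ mean-step n 0≤A 0≤A′ sA′≡nA+l ⟩
    A′ ^ suc n               ∎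
    where
    open ℚ.≤-Reasoning
    sA′≡nA+l : ⟦ suc n ⟧ * A′ ≡ ⟦ n ⟧ * A + l
    sA′≡nA+l = trans eq (trans (cong (λ z → z * l + ⟦ suc d ⟧ * u) (1+n/1 c))
      (trans (lemma ⟦ c ⟧ l (⟦ suc d ⟧ * u)) (cong (_+ l) (sym nA≡s))))

-- For n = c + suc d this is Bernoulli's inequality (u / l) ≥ 1 + (n / suc d) (X / M - 1)
-- when (u / l) ^ suc d ≥ (X / M) ^ n, with the denominators cleared.
tangent : ∀ c d {l u X M} → 0ℚ ≤ l → 0ℚ ≤ u → 0ℚ ≤ X → 0ℚ ≤ M →
          l ^ suc d * X ^ (c ℕ.+ suc d) ≤ u ^ suc d * M ^ (c ℕ.+ suc d) →
          (⟦ c ⟧ + ⟦ suc d ⟧) * (l * X) ≤ (⟦ c ⟧ * l + ⟦ suc d ⟧ * u) * M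
tangent c d {l} {u} {X} {M} 0≤l 0≤u 0≤X 0≤M hyp =
  subst (λ k → k * (l * X) ≤ s * M) (⟦⟧-homo-+ c (suc d)) (finish (mean n {{+suc-nonZero c}} 0≤s))
  where
  n = c ℕ.+ suc d
  s = ⟦ c ⟧ * l + ⟦ suc d ⟧ * u
  0≤s : 0ℚ ≤ s
  0≤s = +-nonneg (*-nonneg (0≤⟦⟧ c) 0≤l) (*-nonneg (0≤⟦⟧ (suc d)) 0≤u)
  finish : ∃[ A ] 0ℚ ≤ A × ⟦ n ⟧ * A ≡ s → ⟦ n ⟧ * (l * X) ≤ s * M
  finish (A , 0≤A , nA≡s) = begin
    ⟦ n ⟧ * (l * X)  ≤⟨ *-monoˡ (0≤⟦⟧ n) (^-cancel-≤ n {{+suc-nonZero c}} (*-nonneg 0≤A 0≤M) powers) ⟩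
    ⟦ n ⟧ * (A * M)  ≡⟨ ℚ.*-assoc ⟦ n ⟧ A M ⟨
    ⟦ n ⟧ * A * M    ≡⟨ cong (_* M) nA≡s ⟩
    s * M            ∎
    where
    open ℚ.≤-Reasoning
    -- Split `l ^ n` as `l ^ c * l ^ suc d`: the second factor is consumed by `hyp`, and AM-GM
    -- bounds the remaining `l ^ c * u ^ suc d` by `A ^ n`.
    powers : (l * X) ^ n ≤ (A * M) ^ n
    powers = begin
      (l * X) ^ n                  ≡⟨ ^-distrib-* l X n ⟩
      l ^ n * X ^ n                ≡⟨ cong (_* X ^ n) (^-homo-* l c (suc d)) ⟩
      l ^ c * l ^ suc d * X ^ n    ≡⟨ ℚ.*-assoc (l ^ c) (l ^ suc d) (X ^ n) ⟩
      l ^ c * (l ^ suc d * X ^ n)  ≤⟨ *-monoˡ (^-nonneg c 0≤l) hyp ⟩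
      l ^ c * (u ^ suc d * M ^ n)  ≡⟨ ℚ.*-assoc (l ^ c) (u ^ suc d) (M ^ n) ⟨
      l ^ c * u ^ suc d * M ^ n    ≤⟨ *-monoʳ (^-nonneg n 0≤M) (weighted-AM-GM c d 0≤l 0≤u 0≤A nA≡s) ⟩
      A ^ n * M ^ n                ≡⟨ ^-distrib-* A M n ⟨
      (A * M) ^ n                  ∎

-- Inequalities for rational exponents at least 2.

-- With t = e - 1 and weights (n - 1) / n, 1 / n, convexity of x ↦ x^t at the points n + 1 and 1,
-- whose mean is n, is (n - 1) (n + 1)^e + (n + 1) ≥ (n + 1) n^e; here e = 2 + c / suc d.
chord-bound : ∀ c d {n l u} → 1ℚ ≤ n → 0ℚ ≤ l → 0ℚ ≤ u →
  let a = c ℕ.+ (suc d ℕ.+ suc d) in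
  l ^ suc d ≤ n ^ a → (n + 1ℚ) ^ a ≤ u ^ suc d →
  (n + 1ℚ) * l ≤ (n - 1ℚ) * u + (n + 1ℚ)
chord-bound c d {n} {l} {u} 1≤n 0≤l 0≤u l≤ ≤u = *-cancelˡ 0<Dn² (0≤-⇒≤
  (lemma n l u ⟦ D ⟧ ⟦ c ⟧)
  -- Both instances of `tangent` express the tangent at `n` of the power with exponent `E / D`,
  -- which is e - 1, evaluated at `n + 1` and at 1. With the factors `n - 1` and `m`, the latter
  -- absorbing a cleared denominator, the slope terms cancel.
  (+-nonneg
    (*-nonneg (≤⇒0≤- 1≤n)
      (≤⇒0≤- (tangent c d (*-nonneg 0≤l 0≤m) (*-nonneg 0≤u 0≤n) 0≤m 0≤n powers₁)))
    (*-nonneg 0≤m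
      (≤⇒0≤- (tangent c d 0≤l 0≤n (ℚ.<⇒≤ 0<1) 0≤n powers₂)))))
  where
  open ℚ.≤-Reasoning
  m = n + 1ℚ
  D = suc d
  E = c ℕ.+ D
  exponent : c ℕ.+ (D ℕ.+ D) ≡ D ℕ.+ E
  exponent = trans (sym (ℕ.+-assoc c D D)) (ℕ.+-comm E D)
  0<n = ℚ.<-≤-trans 0<1 1≤n
  0≤n = ℚ.<⇒≤ 0<n
  0≤m : 0ℚ ≤ m
  0≤m = +-nonneg 0≤n (ℚ.<⇒≤ 0<1)
  0<Dn² : 0ℚ < ⟦ D ⟧ * (n * n)
  0<Dn² = *-pos (0<⟦suc⟧ d) (*-pos 0<n 0<n)
  l≤′ = subst (λ k → l ^ D ≤ n ^ k) exponent l≤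
  ≤u′ = subst (λ k → m ^ k ≤ u ^ D) exponent ≤u
  -- The extra factors `m` and `n` raise the exponent `E` to `D + E`, where the hypotheses on `l`
  -- and `u` apply.
  powers₁ : (l * m) ^ D * m ^ E ≤ (u * n) ^ D * n ^ E
  powers₁ = begin
    (l * m) ^ D * m ^ E        ≡⟨ cong (_* m ^ E) (^-distrib-* l m D) ⟩
    l ^ D * m ^ D * m ^ E      ≡⟨ ℚ.*-assoc (l ^ D) (m ^ D) (m ^ E) ⟩
    l ^ D * (m ^ D * m ^ E)    ≡⟨ cong (l ^ D *_) (^-homo-* m D E) ⟨
    l ^ D * m ^ (D ℕ.+ E)      ≤⟨ *-mono (^-nonneg D 0≤l) l≤′ (^-nonneg (D ℕ.+ E) 0≤m) ≤u′ ⟩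
    n ^ (D ℕ.+ E) * u ^ D      ≡⟨ ℚ.*-comm (n ^ (D ℕ.+ E)) (u ^ D) ⟩
    u ^ D * n ^ (D ℕ.+ E)      ≡⟨ cong (u ^ D *_) (^-homo-* n D E) ⟩
    u ^ D * (n ^ D * n ^ E)    ≡⟨ ℚ.*-assoc (u ^ D) (n ^ D) (n ^ E) ⟨
    u ^ D * n ^ D * n ^ E      ≡⟨ cong (_* n ^ E) (^-distrib-* u n D) ⟨
    (u * n) ^ D * n ^ E        ∎
  powers₂ : l ^ D * 1ℚ ^ E ≤ n ^ D * n ^ E
  powers₂ = begin
    l ^ D * 1ℚ ^ E   ≤⟨ *-monoˡ (^-nonneg D 0≤l) (^≤1 E (ℚ.<⇒≤ 0<1) ℚ.≤-refl) ⟩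
    l ^ D * 1ℚ       ≡⟨ ℚ.*-identityʳ (l ^ D) ⟩
    l ^ D            ≤⟨ l≤′ ⟩
    n ^ (D ℕ.+ E)    ≡⟨ ^-homo-* n D E ⟩
    n ^ D * n ^ E    ∎
  lemma : ∀ n l u D c →
    D * (n * n) * ((n - 1ℚ) * u + (n + 1ℚ)) - D * (n * n) * ((n + 1ℚ) * l) ≡
    (n - 1ℚ) * ((c * (l * (n + 1ℚ)) + D * (u * n)) * n - (c + D) * ((l * (n + 1ℚ)) * (n + 1ℚ)))
    + (n + 1ℚ) * ((c * l + D * n) * n - (c + D) * (l * 1ℚ))
  lemma = solve-∀ ℚ-ring

-- Squaring the ratio (m ± 1) / m before applying Bernoulli's inequality leaves a term
-- 1 / m² on each side, while the linear terms ± 2 / m cancel: this gives strictness.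
second-difference-bound : ∀ c d {m l u v} → 1ℚ ≤ m → 0ℚ ≤ l → 0ℚ ≤ u → 0ℚ ≤ v →
  let n = c ℕ.+ (suc d ℕ.+ suc d) in
  l ^ suc d ≤ m ^ n → (m + 1ℚ) ^ n ≤ u ^ suc d → (m - 1ℚ) ^ n ≤ v ^ suc d →
  (l + l) * (m * m) + (l + l) ≤ m * m * (u + v)
second-difference-bound c d {m} {l} {u} {v} 1≤m 0≤l 0≤u 0≤v l≤ ≤u ≤v = *-cancelˡ 0<D (0≤-⇒≤
  (lemma m l u v ⟦ D ⟧ ⟦ c ⟧)
  (+-nonneg
    (+-nonneg (≤⇒0≤- (bound 0≤m+1 0≤u ≤u)) (≤⇒0≤- (bound 0≤m-1 0≤v ≤v)))
    -- Surplus due to the excess of the exponent over 2; it is dropped.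
    (*-nonneg (0≤⟦⟧ c) (+-nonneg 0≤l 0≤l))))
  where
  open ℚ.≤-Reasoning
  -- Twice the denominator: after squaring the bases the exponent is `n / D`, half of `n / suc d`
  -- and still at least 1.
  D = suc d ℕ.+ suc d
  n = c ℕ.+ D
  0≤m : 0ℚ ≤ m
  0≤m = ℚ.≤-trans (ℚ.<⇒≤ 0<1) 1≤m
  0≤m+1 : 0ℚ ≤ m + 1ℚ
  0≤m+1 = +-nonneg 0≤m (ℚ.<⇒≤ 0<1)
  0≤m-1 : 0ℚ ≤ m - 1ℚ
  0≤m-1 = ≤⇒0≤- 1≤m
  0<D : 0ℚ < ⟦ D ⟧
  0<D = 0<⟦suc⟧ (d ℕ.+ suc d)
  interchange : ∀ a b → a * a * (b * b) ≡ a * b * (a * b)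
  interchange = solve-∀ ℚ-ring
  bound : ∀ {x w} → 0ℚ ≤ x → 0ℚ ≤ w → x ^ n ≤ w ^ suc d →
          (⟦ c ⟧ + ⟦ D ⟧) * (l * (x * x)) ≤ (⟦ c ⟧ * l + ⟦ D ⟧ * w) * (m * m)
  bound {x} {w} 0≤x 0≤w x≤w =
    tangent c (d ℕ.+ suc d) 0≤l 0≤w (*-nonneg 0≤x 0≤x) (*-nonneg 0≤m 0≤m) (begin
      l ^ D * (x * x) ^ n                          ≡⟨ squares l x ⟩
      l ^ suc d * x ^ n * (l ^ suc d * x ^ n)      ≤⟨ *-mono 0≤lx lx≤wm 0≤lx lx≤wm ⟩
      w ^ suc d * m ^ n * (w ^ suc d * m ^ n)      ≡⟨ squares w m ⟨
      w ^ D * (m * m) ^ n                          ∎)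
    where
    squares : ∀ y z → y ^ D * (z * z) ^ n ≡ y ^ suc d * z ^ n * (y ^ suc d * z ^ n)
    squares y z = trans (cong₂ _*_ (^-homo-* y (suc d) (suc d)) (^-distrib-* z z n))
      (interchange (y ^ suc d) (z ^ n))
    0≤lx = *-nonneg (^-nonneg (suc d) 0≤l) (^-nonneg n 0≤x)
    lx≤wm : l ^ suc d * x ^ n ≤ w ^ suc d * m ^ n
    lx≤wm = subst (l ^ suc d * x ^ n ≤_) (ℚ.*-comm (m ^ n) (w ^ suc d))
      (*-mono (^-nonneg (suc d) 0≤l) l≤ (^-nonneg n 0≤x) x≤w)
  lemma : ∀ m l u v D c →
    D * (m * m * (u + v)) - D * ((l + l) * (m * m) + (l + l)) ≡
    ((c * l + D * u) * (m * m) - (c + D) * (l * ((m + 1ℚ) * (m + 1ℚ)))) +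
    ((c * l + D * v) * (m * m) - (c + D) * (l * ((m - 1ℚ) * (m - 1ℚ)))) +
    c * (l + l)
  lemma = solve-∀ ℚ-ring

-- Auxiliary facts on natural numbers and their powers.

-- The condition `1 ≤ m` is there for `i = 0`, because `0ℚ ^ 0` is 1.
⟦⟧-^-monoʳ-≤ : ∀ i {m n} → 1 ℕ.≤ m → m ℕ.≤ n → ⟦ i ⟧ ^ m ≤ ⟦ i ⟧ ^ n
⟦⟧-^-monoʳ-≤ zero {suc m} {n} _ _ =
  subst (_≤ 0ℚ ^ n) (sym (ℚ.*-zeroˡ (0ℚ ^ m))) (^-nonneg n ℚ.≤-refl)
⟦⟧-^-monoʳ-≤ (suc i) _ m≤n = ^-monoʳ-≤ (1≤⟦suc⟧ i) m≤n

^-swap : ∀ x m n → (x ^ m) ^ n ≡ (x ^ n) ^ m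
^-swap x m n = trans (^-assocʳ x m n) (trans (cong (x ^_) (ℕ.*-comm m n)) (sym (^-assocʳ x n m)))

1^≤1 : ∀ n → 1ℚ ^ n ≤ 1ℚ
1^≤1 n = ^≤1 n (ℚ.<⇒≤ 0<1) ℚ.≤-refl

0≤⟦⟧ℝ : ∀ i → 0ℝ ≤ℝ fromℕ i
0≤⟦⟧ℝ i q q<0 = ℚ.<-≤-trans q<0 (0≤⟦⟧ i)

suc-* : ∀ n t → t + ⟦ n ⟧ * t ≡ ⟦ suc n ⟧ * t
suc-* n t = trans (lemma ⟦ n ⟧ t) (cong (_* t) (sym (1+n/1 n)))
  where
  lemma : ∀ n t → t + n * t ≡ (1ℚ + n) * t
  lemma = solve-∀ ℚ-ring

-- From rational bounds to inequalities between reals.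

-- Openness of the lower cut of `y` leaves room above `q` to apply locatedness of `x`. This allows
-- weak inequalities to be proved by contradiction.
≮⇒≥ℝ : ∀ x y → ¬ x <ℝ y → y ≤ℝ x
≮⇒≥ℝ x y x≮y q Lq with lower-open y Lq
... | r , q<r , Lr with located x q<r
...   | inj₁ Lxq = Lxq
...   | inj₂ Uxr = contradiction (r , Uxr , Lr) x≮y

-- The cut of an `n`-fold sum supplies a separate bound for each summand; their maximum serves for
-- all of them at once.
lower-× : ∀ n x {q} → lower (n ×ℝ x) q → ∃[ r ] lower x r × q ≤ ⟦ n ⟧ * r
lower-× zero x q<0 with lower-inhabited x
... | r , Lr = r , Lr , subst (_ ≤_) (sym (ℚ.*-zeroˡ r)) (ℚ.<⇒≤ q<0)
lower-× (suc n) x {q} (r , s , Lr , Ls , q<r+s) with lower-× n x Ls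
... | r′ , Lr′ , s≤nr′ = t , Lt , (begin
    q                ≤⟨ ℚ.<⇒≤ q<r+s ⟩
    r + s            ≤⟨ ℚ.+-mono-≤ (ℚ.p≤p⊔q r r′) (ℚ.≤-trans s≤nr′ (*-monoˡ (0≤⟦⟧ n) (ℚ.p≤q⊔p r r′))) ⟩
    t + ⟦ n ⟧ * t    ≡⟨ suc-* n t ⟩
    ⟦ suc n ⟧ * t    ∎)
  where
  open ℚ.≤-Reasoning
  t = r ℚ.⊔ r′
  Lt : lower x t
  Lt with ℚ.⊔-sel r r′
  ... | inj₁ eq = subst (lower x) (sym eq) Lr
  ... | inj₂ eq = subst (lower x) (sym eq) Lr′

-- Dual to `lower-×`, with the minimum of the separate bounds.
upper-× : ∀ n x {q} → upper (n ×ℝ x) q → ∃[ r ] upper x r × ⟦ n ⟧ * r ≤ q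
upper-× zero x 0<q with upper-inhabited x
... | r , Ur = r , Ur , subst (_≤ _) (sym (ℚ.*-zeroˡ r)) (ℚ.<⇒≤ 0<q)
upper-× (suc n) x {q} (r , s , Ur , Us , r+s<q) with upper-× n x Us
... | r′ , Ur′ , nr′≤s = t , Ut , (begin
    ⟦ suc n ⟧ * t    ≡⟨ suc-* n t ⟨
    t + ⟦ n ⟧ * t    ≤⟨ ℚ.+-mono-≤ (ℚ.p⊓q≤p r r′) (ℚ.≤-trans (*-monoˡ (0≤⟦⟧ n) (ℚ.p⊓q≤q r r′)) nr′≤s) ⟩
    r + s            ≤⟨ ℚ.<⇒≤ r+s<q ⟩
    q                ∎)
  where
  open ℚ.≤-Reasoning
  t = r ℚ.⊓ r′
  Ut : upper x t
  Ut with ℚ.⊓-sel r r′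
  ... | inj₁ eq = subst (upper x) (sym eq) Ur
  ... | inj₂ eq = subst (upper x) (sym eq) Ur′

-- A strict inequality of reals needs a rational witness, hence the uniform margin `η + η`. The
-- witness uses the bounds opposite to those in the hypothesis, so each real is enclosed in a short
-- interval.
difference-< : ∀ x y z {η} → 0ℚ < η →
  (∀ {u l v} → upper z u → lower y l → upper x v → η + η ≤ u + v - (l + l)) →
  y -ℝ x <ℝ z -ℝ y
difference-< x y z {η} 0<η bound = between (approximate x 0<ε) (approximate y 0<ε) (approximate z 0<ε)
  where
  -- Exchanging the bounds costs four interval widths, two of them for `y`; each is below `η * ½`,
  -- so the total stays below `η + η`.
  ε = η * ½
  0<ε : 0ℚ < ε
  0<ε = half-pos 0<η
  Approximation : ℝ → Set
  Approximation w = ∃₂ λ p q → lower w p × upper w q × q - p < ε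
  neg-neg : ∀ p → p ≡ - (- p)
  neg-neg = solve-∀ ℚ-ring
  rearrange : ∀ l₀ u₀ l₁ u₁ l₂ u₂ ε η → l₂ + - u₁ - (u₁ + - l₀) ≡
    (u₂ + u₀ - (l₁ + l₁) - (η + η)) + ((η - (ε + ε)) + (η - (ε + ε))) +
    ((ε - (u₀ - l₀)) + ((ε - (u₁ - l₁)) + (ε - (u₁ - l₁))) + (ε - (u₂ - l₂)))
  rearrange = solve-∀ ℚ-ring
  0≤η-2ε : 0ℚ ≤ η - (ε + ε)
  0≤η-2ε = ≤⇒0≤- (ℚ.≤-reflexive (p½+p½ η))
  between : Approximation x → Approximation y → Approximation z → y -ℝ x <ℝ z -ℝ y
  between (l₀ , u₀ , Ll₀ , Uu₀ , w₀) (l₁ , u₁ , Ll₁ , Uu₁ , w₁) (l₂ , u₂ , Ll₂ , Uu₂ , w₂) =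
    separate (ℚ.<-dense gap)
    where
    gap : u₁ + - l₀ < l₂ + - u₁
    gap = 0<-⇒< (rearrange l₀ u₀ l₁ u₁ l₂ u₂ ε η) (ℚ.+-mono-≤-<
      (+-nonneg (≤⇒0≤- (bound Uu₂ Ll₁ Uu₀)) (+-nonneg 0≤η-2ε 0≤η-2ε))
      (+-pos (+-pos (<⇒0<- w₀) (+-pos (<⇒0<- w₁) (<⇒0<- w₁))) (<⇒0<- w₂)))
    separate : ∃[ q ] u₁ + - l₀ < q × q < l₂ + - u₁ → y -ℝ x <ℝ z -ℝ y
    separate (q , <q , q<) = q ,
      (u₁ , - l₀ , Uu₁ , subst (lower x) (neg-neg l₀) Ll₀ , <q) ,
      (l₂ , - u₁ , Ll₂ , subst (upper y) (neg-neg u₁) Uu₁ , q<)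

-- A rational strictly separating the two sides the wrong way would give, by `upper-×` and
-- `lower-×`, single bounds for `z`, `y` and `x` that violate the hypothesis.
×-difference-≤ : ∀ j k .{{_ : ℕ.NonZero k}} x y z →
  (∀ {u l v} → upper z u → lower y l → upper x v → ⟦ k ⟧ * l ≤ ⟦ j ⟧ * u + ⟦ k ⟧ * v) →
  j ×ℝ z ≥ℝ k ×ℝ (y -ℝ x)
×-difference-≤ j k x y z bound = ≮⇒≥ℝ (j ×ℝ z) (k ×ℝ (y -ℝ x)) λ (q , Uq , Lq) →
  impossible (upper-× j z Uq) (lower-× k (y -ℝ x) Lq)
  where
  lemma : ∀ k j u l s → j * u - k * (l + s) ≡ j * u + k * (- s) - k * l
  lemma = solve-∀ ℚ-ring
  impossible : ∀ {q} → ∃[ u ] upper z u × ⟦ j ⟧ * u ≤ q →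
               ¬ (∃[ w ] lower (y -ℝ x) w × q ≤ ⟦ k ⟧ * w)
  impossible {q} (u , Uu , ju≤q) (w , (l , s , Ll , U-s , w<l+s) , q≤kw) = ℚ.<-irrefl refl (begin-strict
    q                      ≤⟨ q≤kw ⟩
    ⟦ k ⟧ * w              <⟨ ℚ.*-monoʳ-<-pos ⟦ k ⟧ {{ℚ.positive (0<⟦nonZero⟧ k)}} w<l+s ⟩
    ⟦ k ⟧ * (l + s)        ≤⟨ 0≤-⇒≤ (lemma ⟦ k ⟧ ⟦ j ⟧ u l s) (≤⇒0≤- (bound Uu Ll U-s)) ⟩
    ⟦ j ⟧ * u              ≤⟨ ju≤q ⟩
    q                      ∎)
    where open ℚ.≤-Reasoning

∈𝓕-intro : (f : RealFunction) (dom : ∀ k → domain f (fromℕ k)) →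
  let at = λ k → value f (fromℕ k) (dom k) in
  at 0 ≃ℝ 0ℝ →
  (∀ k {u l v} → upper (at (2 ℕ.+ k)) u → lower (at (1 ℕ.+ k)) l → upper (at k) v →
    1ℚ + 1ℚ ≤ ⟦ 1 ℕ.+ k ⟧ * ⟦ 1 ℕ.+ k ⟧ * (u + v - (l + l))) →
  (∀ j n k → 1 ℕ.+ j ≡ n → 1 ℕ.+ n ≡ k →
    ∀ {u l v} → upper (at k) u → lower (at n) l → upper (at 1) v →
    ⟦ k ⟧ * l ≤ ⟦ j ⟧ * u + ⟦ k ⟧ * v) →
  f ∈𝓕
-- The proofs of convex and inequality are named by let so that their types are inferred and
-- match the fields syntactically; checking them directly makes Agda unfold the cuts.
∈𝓕-intro f dom at0≃0 second-difference chord = record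
  { ℕ⊆domain   = dom
  ; at0≃0      = at0≃0
  ; convex     = λ k →
      let m²    = ⟦ 1 ℕ.+ k ⟧ * ⟦ 1 ℕ.+ k ⟧
          -- The margin is `η` = 1 / m², matching the constant 2 in `second-difference`.
          η , 0<η , m²η≡1 = inverse (*-pos (0<⟦suc⟧ k) (0<⟦suc⟧ k))
          strict = difference-< (value f (fromℕ k) (dom k)) (value f (fromℕ (1 ℕ.+ k)) (dom (1 ℕ.+ k)))
                     (value f (fromℕ (2 ℕ.+ k)) (dom (2 ℕ.+ k))) 0<η
                     λ {u} {l} {v} Uu Ll Uv → *-cancelˡ (*-pos (0<⟦suc⟧ k) (0<⟦suc⟧ k))
                       (subst (_≤ m² * (u + v - (l + l)))
                         (sym (trans (ℚ.*-distribˡ-+ m² η η) (cong₂ _+_ m²η≡1 m²η≡1)))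
                         (second-difference k Uu Ll Uv))
      in strict
  ; inequality = λ k 3≤k →
      let bound = ×-difference-≤ (k ℕ.∸ 2) k {{ℕ.>-nonZero (ℕ.≤-trans (ℕ.s≤s ℕ.z≤n) 3≤k)}}
                    (value f (fromℕ 1) (dom 1)) (value f (fromℕ (k ℕ.∸ 1)) (dom (k ℕ.∸ 1)))
                    (value f (fromℕ k) (dom k))
                    -- Since `chord` takes indices linked by equations, the truncated differences
                    -- can be inserted without transport.
                    (chord (k ℕ.∸ 2) (k ℕ.∸ 1) k (1+[k∸2]≡k∸1 k 3≤k) (1+[k∸1]≡k k 3≤k))
      in bound
  }
  where
  1+[k∸2]≡k∸1 : ∀ k → 3 ℕ.≤ k → 1 ℕ.+ (k ℕ.∸ 2) ≡ k ℕ.∸ 1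
  1+[k∸2]≡k∸1 _ (ℕ.s≤s (ℕ.s≤s _)) = refl
  1+[k∸1]≡k : ∀ k → 3 ℕ.≤ k → 1 ℕ.+ (k ℕ.∸ 1) ≡ k
  1+[k∸1]≡k _ (ℕ.s≤s _) = refl

-- Cuts of the powers i^β of natural numbers.

module NaturalPowers (β : ℝ) (2≤β : fromℕ 2 ≤ℝ β) where
  open Bracket

  pow : ℕ → ℝ
  pow i = Power.power (fromℕ i) (0≤⟦⟧ℝ i) β (2≤⇒0< {β} 2≤β)

  2d<a : ∀ a d → upper β (ℤ.+ a / suc d) → 2 ℕ.* suc d ℕ.< a
  2d<a a d Ua = subst (2 ℕ.* suc d ℕ.<_) (ℕ.*-identityʳ a)
    (frac<⇒ 2 0 a d (≤⇒upper (fromℕ 2) β 2≤β Ua))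

  split-exponent : ∀ a d → upper β (ℤ.+ a / suc d) → ∃[ c ] c ℕ.+ (suc d ℕ.+ suc d) ≡ a
  split-exponent a d Ua = a ℕ.∸ D , ℕ.m∸n+n≡m
    (subst (λ k → suc d ℕ.+ k ℕ.≤ a) (ℕ.+-identityʳ (suc d)) (ℕ.<⇒≤ (2d<a a d Ua)))
    where D = suc d ℕ.+ suc d

  -- Only the upper end of the bracket is kept: that exponent exceeds β and hence 2.
  upper⇒exponent : ∀ i {u} → upper (pow i) u →
    ∃₂ λ a d → upper β (ℤ.+ a / suc d) × ⟦ i ⟧ ^ a ≤ u ^ suc d
  upper⇒exponent i (0<u , s , B , i<s , _ , <u) =
    a′ B , b B , β<a′/b B , ℚ.≤-trans (^-monoˡ-≤ (a′ B) (0≤⟦⟧ i) (ℚ.<⇒≤ i<s)) (ℚ.<⇒≤ <u)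

  -- For `i ≥ 1` lowering the exponent lowers the power; for `i = 0` both powers vanish, as `a` is
  -- positive. Clearing roots means comparing powers with exponents `a * suc d′` and `a′ * suc d`.
  shrink-exponent : ∀ i a d a′ d′ {u} → 0ℚ ≤ u → upper β (ℤ.+ a / suc d) →
    a ℕ.* suc d′ ℕ.≤ a′ ℕ.* suc d →
    ⟦ i ⟧ ^ a′ ≤ u ^ suc d′ → ⟦ i ⟧ ^ a ≤ u ^ suc d
  shrink-exponent i a d a′ d′ {u} 0≤u Ua ad′≤a′d i≤u = ^-cancel-≤ (suc d′) (^-nonneg (suc d) 0≤u) (begin
    (⟦ i ⟧ ^ a) ^ suc d′       ≡⟨ ^-assocʳ ⟦ i ⟧ a (suc d′) ⟩
    ⟦ i ⟧ ^ (a ℕ.* suc d′)     ≤⟨ ⟦⟧-^-monoʳ-≤ i 1≤ad′ ad′≤a′d ⟩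
    ⟦ i ⟧ ^ (a′ ℕ.* suc d)     ≡⟨ ^-assocʳ ⟦ i ⟧ a′ (suc d) ⟨
    (⟦ i ⟧ ^ a′) ^ suc d       ≤⟨ ^-monoˡ-≤ (suc d) (^-nonneg a′ (0≤⟦⟧ i)) i≤u ⟩
    (u ^ suc d′) ^ suc d       ≡⟨ ^-swap u (suc d′) (suc d) ⟩
    (u ^ suc d) ^ suc d′       ∎)
    where
    open ℚ.≤-Reasoning
    1≤ad′ : 1 ℕ.≤ a ℕ.* suc d′
    1≤ad′ = ℕ.*-mono-≤ (ℕ.≤-<-trans ℕ.z≤n (2d<a a d Ua)) (ℕ.s≤s ℕ.z≤n)

  -- The smaller of the two exponents works for both bounds and is still above β.
  common-exponent : ∀ i j {u v} → upper (pow i) u → upper (pow j) v →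
    ∃₂ λ a d → upper β (ℤ.+ a / suc d) × ⟦ i ⟧ ^ a ≤ u ^ suc d × ⟦ j ⟧ ^ a ≤ v ^ suc d
  common-exponent i j {u} {v} Uu Uv = choose (upper⇒exponent i Uu) (upper⇒exponent j Uv)
    where
    choose : (∃₂ λ a d → upper β (ℤ.+ a / suc d) × ⟦ i ⟧ ^ a ≤ u ^ suc d) →
             (∃₂ λ a d → upper β (ℤ.+ a / suc d) × ⟦ j ⟧ ^ a ≤ v ^ suc d) →
             ∃₂ λ a d → upper β (ℤ.+ a / suc d) × ⟦ i ⟧ ^ a ≤ u ^ suc d × ⟦ j ⟧ ^ a ≤ v ^ suc d
    choose (a , d , Ua , i≤u) (a′ , d′ , Ua′ , j≤v) with ℕ.≤-total (a ℕ.* suc d′) (a′ ℕ.* suc d)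
    ... | inj₁ le = a , d , Ua , i≤u , shrink-exponent j a d a′ d′ (ℚ.<⇒≤ (proj₁ Uv)) Ua le j≤v
    ... | inj₂ ge = a′ , d′ , Ua′ , shrink-exponent i a′ d′ a d (ℚ.<⇒≤ (proj₁ Uu)) Ua′ ge i≤u , j≤v

  -- The lower end of the bracket behind `l` is below β, hence below `a / suc d`; for a base at
  -- least 1 the power only grows. So lower bounds tolerate every rational exponent above β.
  lower⇒^≤ : ∀ i a d {l} → upper β (ℤ.+ a / suc d) → lower (pow i) l → 0ℚ ≤ l →
             l ^ suc d ≤ ⟦ i ⟧ ^ a
  lower⇒^≤ i a d Ua (inj₁ l<0) 0≤l = contradiction (ℚ.<-≤-trans l<0 0≤l) (ℚ.<-irrefl refl)
  -- No positive `r` lies below 0, so 0^β has only negative lower bounds.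
  lower⇒^≤ zero a d Ua (inj₂ (_ , r , _ , 0<r , r<0 , _)) _ = contradiction r<0 (ℚ.<-asym 0<r)
  lower⇒^≤ (suc i) a d {l} Ua (inj₂ (_ , r , C , 0<r , r<i , l< , _)) 0≤l =
    ^-cancel-≤ e (^-nonneg a (0≤⟦⟧ (suc i))) (begin
      (l ^ suc d) ^ e                ≡⟨ ^-swap l (suc d) e ⟩
      (l ^ e) ^ suc d                ≤⟨ ^-monoˡ-≤ (suc d) (^-nonneg e 0≤l) (ℚ.<⇒≤ l<) ⟩
      (r ^ Bracket.a C) ^ suc d      ≤⟨ ^-monoˡ-≤ (suc d) (^-nonneg (Bracket.a C) (ℚ.<⇒≤ 0<r))
                                          (^-monoˡ-≤ (Bracket.a C) (ℚ.<⇒≤ 0<r) (ℚ.<⇒≤ r<i)) ⟩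
      (x ^ Bracket.a C) ^ suc d      ≡⟨ ^-assocʳ x (Bracket.a C) (suc d) ⟩
      x ^ (Bracket.a C ℕ.* suc d)    ≤⟨ ^-monoʳ-≤ (1≤⟦suc⟧ i) (ℕ.<⇒≤
                                          (frac<⇒ (Bracket.a C) (b C) a d (lower<upper β (a/b<β C) Ua))) ⟩
      x ^ (a ℕ.* e)                  ≡⟨ ^-assocʳ x a e ⟨
      (x ^ a) ^ e                    ∎)
    where
    open ℚ.≤-Reasoning
    e = suc (b C)
    x = ⟦ suc i ⟧

  upper-pow1 : ∀ {v} → upper (pow 1) v → 1ℚ ≤ v
  upper-pow1 (0<v , s , B , 1<s , <v , _) = ^-cancel-≤ (suc (b B)) (ℚ.<⇒≤ 0<v)
    (ℚ.≤-trans (1^≤1 (suc (b B))) (ℚ.≤-trans (1≤^ (a B) (ℚ.<⇒≤ 1<s)) (ℚ.<⇒≤ <v)))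

  -- The exponent is taken from `u` alone: `v` enters only through `1 ≤ v`, which accounts for the
  -- summand `n + 1` in `chord-bound`. Nonpositive `l` is treated apart because `chord-bound` needs
  -- `0 ≤ l`.
  chord-cuts : ∀ j n k → 1 ℕ.+ j ≡ n → 1 ℕ.+ n ≡ k → ∀ {u l v} →
               upper (pow k) u → lower (pow n) l → upper (pow 1) v →
               ⟦ k ⟧ * l ≤ ⟦ j ⟧ * u + ⟦ k ⟧ * v
  chord-cuts j n k 1+j≡n 1+n≡k {u} {l} {v} Uu Ll Uv with ℚ.≤-total 0ℚ l
  ... | inj₂ l≤0 = begin
    ⟦ k ⟧ * l                ≤⟨ *-monoˡ (0≤⟦⟧ k) l≤0 ⟩
    ⟦ k ⟧ * 0ℚ               ≡⟨ ℚ.*-zeroʳ ⟦ k ⟧ ⟩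
    0ℚ                       ≤⟨ +-nonneg (*-nonneg (0≤⟦⟧ j) (ℚ.<⇒≤ (proj₁ Uu)))
                                         (*-nonneg (0≤⟦⟧ k) (ℚ.<⇒≤ (proj₁ Uv))) ⟩
    ⟦ j ⟧ * u + ⟦ k ⟧ * v    ∎
    where open ℚ.≤-Reasoning
  ... | inj₁ 0≤l = bound (upper⇒exponent k Uu)
    where
    open ℚ.≤-Reasoning
    1≤n : 1ℚ ≤ ⟦ n ⟧
    1≤n = subst (λ i → 1ℚ ≤ ⟦ i ⟧) 1+j≡n (1≤⟦suc⟧ j)
    n+1 : ⟦ k ⟧ ≡ ⟦ n ⟧ + 1ℚ
    n+1 = trans (cong ⟦_⟧ (sym 1+n≡k)) (trans (1+n/1 n) (ℚ.+-comm 1ℚ ⟦ n ⟧))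
    n-1 : ⟦ n ⟧ - 1ℚ ≡ ⟦ j ⟧
    n-1 = trans (cong (_- 1ℚ) (trans (cong ⟦_⟧ (sym 1+j≡n)) (1+n/1 j))) (lemma ⟦ j ⟧)
      where
      lemma : ∀ p → 1ℚ + p - 1ℚ ≡ p
      lemma = solve-∀ ℚ-ring
    bound : (∃₂ λ a d → upper β (ℤ.+ a / suc d) × ⟦ k ⟧ ^ a ≤ u ^ suc d) →
            ⟦ k ⟧ * l ≤ ⟦ j ⟧ * u + ⟦ k ⟧ * v
    bound (a , d , Ua , k≤u) with split-exponent a d Ua
    ... | c , refl = begin
      ⟦ k ⟧ * l                         ≡⟨ cong (_* l) n+1 ⟩
      (⟦ n ⟧ + 1ℚ) * l                  ≤⟨ chord-bound c d 1≤n 0≤l (ℚ.<⇒≤ (proj₁ Uu))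
                                             (lower⇒^≤ n a d Ua Ll 0≤l)
                                             (subst (λ x → x ^ a ≤ u ^ suc d) n+1 k≤u) ⟩
      (⟦ n ⟧ - 1ℚ) * u + (⟦ n ⟧ + 1ℚ)   ≡⟨ cong₂ (λ x y → x * u + y) n-1
                                             (sym (trans (ℚ.*-identityʳ ⟦ k ⟧) n+1)) ⟩
      ⟦ j ⟧ * u + ⟦ k ⟧ * 1ℚ            ≤⟨ ℚ.+-monoʳ-≤ (⟦ j ⟧ * u) (*-monoˡ (0≤⟦⟧ k) (upper-pow1 Uv)) ⟩
      ⟦ j ⟧ * u + ⟦ k ⟧ * v             ∎

  second-difference-cuts : ∀ k {u l v} →
    upper (pow (2 ℕ.+ k)) u → lower (pow (1 ℕ.+ k)) l → upper (pow k) v →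
    1ℚ + 1ℚ ≤ ⟦ 1 ℕ.+ k ⟧ * ⟦ 1 ℕ.+ k ⟧ * (u + v - (l + l))
  second-difference-cuts k {u} {l} {v} Uu Ll Uv = bound (common-exponent (2 ℕ.+ k) k Uu Uv)
    where
    m = ⟦ 1 ℕ.+ k ⟧
    0≤m² = *-nonneg (0≤⟦⟧ (1 ℕ.+ k)) (0≤⟦⟧ (1 ℕ.+ k))
    -- Raising `l` to at least 1 makes the surplus `l′ + l′` of `second-difference-bound` at least
    -- 2, and `l′` remains admissible because `m ^ a` is at least 1.
    l′ = 1ℚ ℚ.⊔ l
    1≤l′ = ℚ.p≤p⊔q 1ℚ l
    l≤l′ = ℚ.p≤q⊔p 1ℚ l
    0≤l′ = ℚ.≤-trans (ℚ.<⇒≤ 0<1) 1≤l′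
    m+1 : ⟦ 2 ℕ.+ k ⟧ ≡ m + 1ℚ
    m+1 = trans (1+n/1 (1 ℕ.+ k)) (ℚ.+-comm 1ℚ m)
    m-1 : ⟦ k ⟧ ≡ m - 1ℚ
    m-1 = trans (lemma ⟦ k ⟧) (cong (_- 1ℚ) (sym (1+n/1 k)))
      where
      lemma : ∀ p → p ≡ 1ℚ + p - 1ℚ
      lemma = solve-∀ ℚ-ring
    lemma : ∀ M s l l′ → M * (s - (l + l)) - (1ℚ + 1ℚ) ≡
      M * s - ((l′ + l′) * M + (l′ + l′)) + M * ((l′ - l) + (l′ - l)) + ((l′ - 1ℚ) + (l′ - 1ℚ))
    lemma = solve-∀ ℚ-ring
    bound : (∃₂ λ a d → upper β (ℤ.+ a / suc d) × ⟦ 2 ℕ.+ k ⟧ ^ a ≤ u ^ suc d × ⟦ k ⟧ ^ a ≤ v ^ suc d) →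
            1ℚ + 1ℚ ≤ m * m * (u + v - (l + l))
    bound (a , d , Ua , ≤u , ≤v) with split-exponent a d Ua
    ... | c , refl = 0≤-⇒≤ (lemma (m * m) (u + v) l l′)
      (+-nonneg
        (+-nonneg
          (≤⇒0≤- (second-difference-bound c d (1≤⟦suc⟧ k) 0≤l′ (ℚ.<⇒≤ (proj₁ Uu)) (ℚ.<⇒≤ (proj₁ Uv)) l′≤
            (subst (λ x → x ^ a ≤ u ^ suc d) m+1 ≤u) (subst (λ x → x ^ a ≤ v ^ suc d) m-1 ≤v)))
          (*-nonneg 0≤m² (+-nonneg (≤⇒0≤- l≤l′) (≤⇒0≤- l≤l′))))
        (+-nonneg (≤⇒0≤- 1≤l′) (≤⇒0≤- 1≤l′)))
      where
      l′≤ : l′ ^ suc d ≤ m ^ a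
      l′≤ with ℚ.⊔-sel 1ℚ l
      ... | inj₁ eq = subst (λ x → x ^ suc d ≤ m ^ a) (sym eq)
                        (ℚ.≤-trans (1^≤1 (suc d)) (1≤^ a (1≤⟦suc⟧ k)))
      ... | inj₂ eq = subst (λ x → x ^ suc d ≤ m ^ a) (sym eq)
                        (lower⇒^≤ (1 ℕ.+ k) a d Ua Ll (subst (0ℚ ≤_) eq 0≤l′))

  pow0≃0 : pow 0 ≃ℝ 0ℝ
  pow0≃0 = pow0≤0 , λ p p<0 → inj₁ p<0
    where
    pow0≤0 : pow 0 ≤ℝ 0ℝ
    pow0≤0 p (inj₁ p<0) = p<0
    pow0≤0 p (inj₂ (_ , r , _ , 0<r , r<0 , _)) = contradiction r<0 (ℚ.<-asym 0<r)

theorem6 : (β : ℝ) (β≥2 : β ≥ℝ fromℕ 2) → powerFunction β (2≤⇒0< {β} β≥2) ∈𝓕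
theorem6 β β≥2 = ∈𝓕-intro (powerFunction β (2≤⇒0< {β} β≥2)) 0≤⟦⟧ℝ pow0≃0
  second-difference-cuts chord-cuts
  where open NaturalPowers β β≥2
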